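{- Let $c>1$ be an integer constant. Then: (1) There is a constant $\kappa_1>0$ such that for every sufficiently large integer $\alpha$ and every leader election algorithm with advice that works in time at most $D+\phi+c$ in all feasible graphs (of diameter $D$ and election index $\phi$), there exists a feasible graph with election index at most $\alpha$ in which this algorithm uses advice of length at least $\kappa_1\log\alpha$. (2) There is a constant $\kappa_2>0$ such that for every sufficiently large integer $\alpha$ and every leader election algorithm with advice that works in time at most $D+c\phi$ in all feasible graphs, there exists a feasible graph with election index at most $\alpha$ in which this algorithm uses advice of length at least $\kappa_2\log\log\alpha$. (3) There is a constant $\kappa_3>0$ such that for every sufficiently large integer $\alpha$ and every leader election algorithm with advice that works in time at most $D+\phi^c$ in all feasible graphs, there exists a feasible graph with election index at most $\alpha$ in which this algorithm uses advice of length at least $\kappa_3\log\log\log\alpha$. (4) There is a constant $\kappa_4>0$ such that for every sufficiently large integer $\alpha$ and every leader election algorithm with advice that works in time at most $D+c^{\phi}$ in all feasible graphs, there exists a feasible graph with election index at most $\alpha$ in which this algorithm uses advice of length at least $\kappa_4\log(\log^*\alpha)$.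
   Context: A graph is a simple undirected connected graph with $n\ge 3$ anonymous nodes; at each node of degree $d$ the incident edges carry distinct port numbers $0,\dots,d-1$ (local, unrelated at the two endpoints of an edge). The truncated view $\mathcal{V}^l(v)$ is defined inductively: $\mathcal{V}^0(v)$ is a single node; $\mathcal{V}^{l+1}(v)$ is the port-labeled tree rooted at $x_0$ having, for each neighbor $v_i$ of $v$, a child $x_i$ with the ports of edge $\{x_0,x_i\}$ equal to the ports of edge $\{v,v_i\}$ at $v$ and at $v_i$ respectively, and $x_i$ the root of a copy of $\mathcal{V}^l(v_i)$; the view is the infinite limit. The augmented truncated view $\mathcal{B}^l(v)$ is $\mathcal{V}^l(v)$ with leaves labeled by their degrees. A graph is feasible if all node views are distinct. Model: synchronous rounds (LOCAL), all nodes start simultaneously, each round each node exchanges arbitrary messages with all neighbors; initially a node knows only its degree and the advice, so after $r$ rounds its knowledge is the advice and $\mathcal{B}^r(v)$. Leader election: each node $v$ outputs $(p_1,q_1,\dots,p_k,q_k)$ such that the path from $v$ whose $i$-th edge has port $p_i$ at the endpoint nearer $v$ and $q_i$ at the other endpoint is a simple path, and all these paths end at a common node. Time = number of rounds until all nodes output. $D$ denotes the diameter of the graph. The election index $\phi$ of a feasible graph is the minimum time in which leader election is possible when nodes know the map of the graph (isomorphic copy with ports); equivalently, the smallest $\ell$ such that all $\mathcal{B}^\ell(v)$ are distinct. Advice: an oracle knowing the whole graph gives the same binary string to all nodes at the start; a leader election algorithm with advice consists of such an oracle and a deterministic distributed algorithm. Logarithms are base 2 and $\log^*$ is the iterated logarithm.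 -}

module Defs where

open import Data.Nat using (ℕ; zero; suc; _+_; _*_; _≤_; _<_; _≤ᵇ_; NonZero)
open import Data.Nat.Logarithm using (⌊log₂_⌋)
open import Data.Fin using (Fin; toℕ)
open import Data.List using (List; []; _∷_; map; allFin; length)
open import Data.List.Relation.Unary.Unique.Propositional using (Unique)
open import Data.Maybe using (Maybe; just; nothing)
open import Data.Bool using (Bool; if_then_else_)
open import Data.Product using (Σ; ∃; _×_; _,_; proj₁; proj₂)
open import Relation.Binary.PropositionalEquality using (_≡_; _≢_)
open import Relation.Nullary using (¬_)

-- Port-labeled graphs.  Nodes are Fin n (anonymous: nothing in the
-- model lets algorithms see node names).  At node v the incident edges
-- carry ports 0..deg v - 1 (the elements of Fin (deg v));
-- nbr v i = (u , j) means: the edge with port i at v leads to u and has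
-- port j at u.

record Graph : Set where
  field
    n   : ℕ
    deg : Fin n → ℕ
    nbr : (v : Fin n) → Fin (deg v) → Σ (Fin n) (λ u → Fin (deg u))

module _ (G : Graph) where
  open Graph G

  Adj : Fin n → Fin n → Set
  Adj u w = ∃ λ (i : Fin (deg u)) → proj₁ (nbr u i) ≡ w

  data Within : ℕ → Fin n → Fin n → Set where
    here : ∀ {k v} → Within k v v
    step : ∀ {k u w v} → Adj u w → Within k w v → Within (suc k) u v

  Connected : Set
  Connected = ∃ λ d → ∀ u v → Within d u v

  IsDiameter : ℕ → Set
  IsDiameter D = (∀ u v → Within D u v)
               × (∀ d → (∀ u v → Within d u v) → D ≤ d)

record IsGraph (G : Graph) : Set where
  open Graph G
  field
    three≤n   : 3 ≤ n
    symmetric : ∀ v (i : Fin (deg v)) u (j : Fin (deg u)) →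
                nbr v i ≡ (u , j) → nbr u j ≡ (v , i)
    noLoop    : ∀ v (i : Fin (deg v)) → proj₁ (nbr v i) ≢ v
    noMulti   : ∀ v (i i' : Fin (deg v)) →
                proj₁ (nbr v i) ≡ proj₁ (nbr v i') → i ≡ i'
    connected : Connected G

-- Truncated views as port-labeled rooted trees.
-- A child entry (p , q , t): edge with port p at the parent and q at
-- the child, t the subtree rooted at the child.  Children are listed in
-- the order of the ports at the parent.

data View : Set where
  bare : View
  leaf : ℕ → View
  node : List (ℕ × ℕ × View) → View

module _ (G : Graph) where
  open Graph G

  𝒱 : ℕ → Fin n → View
  𝒱 zero    v = bare
  𝒱 (suc l) v = node (map (λ i → toℕ i , toℕ (proj₂ (nbr v i)) , 𝒱 l (proj₁ (nbr v i)))
                          (allFin (deg v)))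

  ℬ : ℕ → Fin n → View
  ℬ zero    v = leaf (deg v)
  ℬ (suc l) v = node (map (λ i → toℕ i , toℕ (proj₂ (nbr v i)) , ℬ l (proj₁ (nbr v i)))
                          (allFin (deg v)))

  -- feasible: all (infinite) views distinct; two infinite views are
  -- equal iff all their truncations are equal.
  Feasible : Set
  Feasible = ∀ u v → u ≢ v → ∃ λ l → 𝒱 l u ≢ 𝒱 l v

  DistinctB : ℕ → Set
  DistinctB l = ∀ u v → ℬ l u ≡ ℬ l v → u ≡ v

  IsElectionIndex : ℕ → Set
  IsElectionIndex φ = DistinctB φ × (∀ l → DistinctB l → φ ≤ l)

  data Walk : Fin n → List (ℕ × ℕ) → Fin n → List (Fin n) → Set where
    stop : ∀ {v} → Walk v [] v (v ∷ [])
    go   : ∀ {v w ps vs} (i : Fin (deg v)) →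
           Walk (proj₁ (nbr v i)) ps w vs →
           Walk v ((toℕ i , toℕ (proj₂ (nbr v i))) ∷ ps) w (v ∷ vs)

  SimplePath : Fin n → List (ℕ × ℕ) → Fin n → Set
  SimplePath v ps w = ∃ λ vs → Walk v ps w vs × Unique vs

-- Leader election with advice.
-- Output of a node: the sequence (p₁,q₁,…,p_k,q_k) as a list of pairs.

Output : Set
Output = List (ℕ × ℕ)

Oracle : Set
Oracle = Graph → List Bool

-- A deterministic distributed algorithm: after r rounds a node's
-- knowledge is the advice and ℬ^r(v); at round r it either outputs
-- (just o) or waits (nothing).  A node outputs at the first round at
-- which the algorithm returns just.
DistAlg : Set
DistAlg = List Bool → (r : ℕ) → View → Maybe Output

module _ (G : Graph) where
  open Graph G

  OutputsAt : DistAlg → List Bool → Fin n → ℕ → Output → Set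
  OutputsAt A adv v r o =
    A adv r (ℬ G r v) ≡ just o × (∀ r' → r' < r → A adv r' (ℬ G r' v) ≡ nothing)

  ElectsWithin : DistAlg → List Bool → ℕ → Set
  ElectsWithin A adv T =
    Σ (Fin n → Output) λ out →
      (∀ v → ∃ λ r → r ≤ T × OutputsAt A adv v r (out v)) ×
      (∃ λ ℓ → ∀ v → SimplePath G v (out v) ℓ)

WorksInTime : (ℕ → ℕ → ℕ) → Oracle → DistAlg → Set
WorksInTime T O A =
  ∀ (G : Graph) → IsGraph G → Feasible G →
  ∀ D φ → IsDiameter G D → IsElectionIndex G φ →
  ElectsWithin G A (O G) (T D φ)

-- Lower bound "advice ≥ κ·f(α)" for some constant κ > 0, every
-- sufficiently large α and every algorithm working in time T.
-- κ is represented as 1/k for a positive integer k.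
AdviceLowerBound : (ℕ → ℕ → ℕ) → (ℕ → ℕ) → Set
AdviceLowerBound T f =
  ∃ λ k → NonZero k × ∃ λ α₀ → ∀ α → α₀ ≤ α →
  ∀ (O : Oracle) (A : DistAlg) → WorksInTime T O A →
  ∃ λ (G : Graph) → IsGraph G × Feasible G ×
    (∃ λ φ → IsElectionIndex G φ × φ ≤ α) ×
    f α ≤ k * length (O G)

-- iterated logarithm log* (with ⌊log₂⌋); fuel x suffices
log*-aux : ℕ → ℕ → ℕ
log*-aux zero    x = 0
log*-aux (suc f) x = if x ≤ᵇ 1 then 0 else suc (log*-aux f ⌊log₂ x ⌋)

log* : ℕ → ℕ
log* x = log*-aux x x

{-# OPTIONS --safe #-}

-- All graphs used are rings of cores, labelled by attaching f x pendant leaves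
-- to the core at x, with consistently oriented ports.  The view of a core is
-- then the word of labels around it, so a ring is indistinguishable from any
-- other ring containing a sufficiently long piece of its periodic unrolling,
-- and the election index is governed by how long a window of labels must be to
-- determine its position.
--
-- Let the time be D + τ φ and let two such rings with disjoint labels receive
-- the same advice.  Paste one
-- period of each, prolonged periodically by s = τ φ + O(1) on both sides, into a
-- bigger ring, separated by long blocks of unique labels.  The cores opposite to
-- the two seams run for at most D + τ φ rounds and do not notice the change;
-- they still output the same paths, now too short to meet, so the bigger ring cannot
-- receive that advice.  A window of radius s reaches a unique label from
-- everywhere the unrolling repeats itself, so the new election index is only
-- τ φ + O(1).  Conflicts persist under further pasting: after i rounds i advice
-- strings are excluded, and with 2 ^ L rounds all strings shorter than L are.
module Submission where

open import Defs
open import Data.Bool using (Bool; true; false; T)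
open import Data.Empty using (⊥-elim)
open import Data.Fin as Fin using (Fin; zero; suc; toℕ; _↑ˡ_; _↑ʳ_; splitAt)
import Data.Fin.Properties as Fin
open import Data.List using (List; []; _∷_; _++_; map; allFin; length; lookup; tabulate)
open import Data.List.Membership.Propositional using (_∈_)
open import Data.List.Membership.Propositional.Properties using (∈-map⁺; ∈-++⁺ˡ; ∈-++⁺ʳ)
open import Data.List.Properties
  using (∷-injective; length-++; length-map; length-tabulate; map-cong; map-tabulate; tabulate-cong)
open import Data.List.Relation.Unary.Any using (here; there; index)
open import Data.List.Relation.Unary.Any.Properties using (lookup-index)
open import Data.Maybe using (just; nothing)
open import Data.Nat
open import Data.Nat.DivMod
  using (_%_; _mod_; m%n%n≡m%n; m%n<n; m<n⇒m%n≡m; [m+n]%n≡m%n; [m+kn]%n≡m%n; %-distribˡ-+)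
open import Data.Nat.Logarithm
open import Data.Nat.Properties
open import Data.Nat.Tactic.RingSolver using (solve-∀)
open import Data.Product using (Σ; ∃; ∃₂; _×_; _,_; proj₁; proj₂)
open import Data.Sum using (_⊎_; inj₁; inj₂)
open import Data.Unit using (tt)
open import Function using (_∘_; id)
open import Relation.Binary using (tri<; tri≈; tri>)
open import Relation.Binary.PropositionalEquality
open import Relation.Nullary using (¬_; Dec; yes; no)
open import Relation.Nullary.Decidable using (map′; _×-dec_; _→-dec_)

-- Minimal witnesses and decidable equality of views.

least : {P : ℕ → Set} → (∀ n → Dec (P n)) → ∀ n → P n →
        ∃ λ m → m ≤ n × P m × (∀ l → P l → m ≤ l)
least P? zero    p = 0 , z≤n , p , λ _ _ → z≤n
least P? (suc n) p with P? 0
... | yes p₀ = 0 , z≤n , p₀ , λ _ _ → z≤n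
... | no ¬p₀ with least (P? ∘ suc) n p
... | m , m≤n , pm , min = suc m , s≤s m≤n , pm , λ where
  zero    p₀ → ⊥-elim (¬p₀ p₀)
  (suc l) pl → s≤s (min l pl)

mutual
  _≟ⱽ_ : (s t : View) → Dec (s ≡ t)
  bare   ≟ⱽ bare   = yes refl
  bare   ≟ⱽ leaf _ = no λ ()
  bare   ≟ⱽ node _ = no λ ()
  leaf _ ≟ⱽ bare   = no λ ()
  leaf m ≟ⱽ leaf n = map′ (cong leaf) (λ { refl → refl }) (m ≟ n)
  leaf _ ≟ⱽ node _ = no λ ()
  node _ ≟ⱽ bare   = no λ ()
  node _ ≟ⱽ leaf _ = no λ ()
  node s ≟ⱽ node t = map′ (cong node) (λ { refl → refl }) (s ≟ᶜ t)

  _≟ᶜ_ : (s t : List (ℕ × ℕ × View)) → Dec (s ≡ t)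
  [] ≟ᶜ []      = yes refl
  [] ≟ᶜ (_ ∷ _) = no λ ()
  (_ ∷ _) ≟ᶜ [] = no λ ()
  ((p , q , s) ∷ ss) ≟ᶜ ((p′ , q′ , s′) ∷ ss′) =
    map′ (λ { (refl , refl , refl , refl) → refl }) (λ { refl → refl , refl , refl , refl })
         (p ≟ p′ ×-dec q ≟ q′ ×-dec s ≟ⱽ s′ ×-dec ss ≟ᶜ ss′)

node-injective : ∀ {s t} → node s ≡ node t → s ≡ t
node-injective refl = refl

-- Existence of the diameter and of the election index.

module _ (G : Graph) where
  open Graph G

  distinctB? : ∀ l → Dec (DistinctB G l)
  distinctB? l = Fin.all? λ u → Fin.all? λ v → (ℬ G l u ≟ⱽ ℬ G l v) →-dec (u Fin.≟ v)

  within? : ∀ k u v → Dec (Within G k u v)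
  within? zero u v = map′ (λ { refl → here }) (λ { here → refl }) (u Fin.≟ v)
  within? (suc k) u v with u Fin.≟ v
  ... | yes refl = yes here
  ... | no u≢v = map′ (λ { (i , w) → step (i , refl) w })
                      (λ { here → ⊥-elim (u≢v refl) ; (step (i , refl) w) → i , w })
                      (Fin.any? λ i → within? k (proj₁ (nbr u i)) v)

  within-mono : ∀ {k l u v} → k ≤ l → Within G k u v → Within G l u v
  within-mono _         here       = here
  within-mono (s≤s k≤l) (step a w) = step a (within-mono k≤l w)

  within-trans : ∀ {k l u v w} → Within G k u v → Within G l v w → Within G (k + l) u w
  within-trans {k} {l} here w′      = within-mono (m≤n+m l k) w′
  within-trans         (step a w) w′ = step a (within-trans w w′)

  diameter : ∀ d → (∀ u v → Within G d u v) → ∃ λ D → D ≤ d × IsDiameter G D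
  diameter d w =
    least (λ k → Fin.all? λ u → Fin.all? λ v → within? k u v) d w

  electionIndex : ∀ r → DistinctB G r → ∃ λ φ → φ ≤ r × IsElectionIndex G φ
  electionIndex r dist = least distinctB? r dist

  private
    children : ∀ {A : Set} (t : Fin n → A) v → Fin (deg v) → ℕ × ℕ × A
    children t v i = toℕ i , toℕ (proj₂ (nbr v i)) , t (proj₁ (nbr v i))

  𝒱-degree : ∀ l u v → 𝒱 G (suc l) u ≡ 𝒱 G (suc l) v → deg u ≡ deg v
  𝒱-degree l u v eq = begin
    deg u                           ≡⟨ len u ⟨
    length (map (children (𝒱 G l) u) (allFin (deg u))) ≡⟨ cong length (node-injective eq) ⟩
    length (map (children (𝒱 G l) v) (allFin (deg v))) ≡⟨ len v ⟩
    deg v                           ∎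
    where
    open ≡-Reasoning
    len : ∀ w → length (map (children (𝒱 G l) w) (allFin (deg w))) ≡ deg w
    len w = trans (length-map _ (allFin (deg w))) (length-tabulate {n = deg w} id)

  -- The additional level of the bare view shows how many children each node at depth `l` has, and
  -- these numbers are the degrees that label the leaves of `ℬ`.
  𝒱-ℬ : ∀ l u v → 𝒱 G (suc l) u ≡ 𝒱 G (suc l) v → ℬ G l u ≡ ℬ G l v
  𝒱-ℬ zero    u v eq = cong leaf (𝒱-degree 0 u v eq)
  𝒱-ℬ (suc l) u v eq = cong node (truncate (allFin (deg u)) (allFin (deg v)) (node-injective eq))
    where
    truncate : ∀ is js → map (children (𝒱 G (suc l)) u) is ≡ map (children (𝒱 G (suc l)) v) js →
         map (children (ℬ G l) u) is ≡ map (children (ℬ G l) v) js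
    truncate []       []       _  = refl
    truncate (i ∷ is) (j ∷ js) eq with ∷-injective eq
    ... | eq₀ , eqs = cong₂ _∷_
      (cong₂ _,_ (cong proj₁ eq₀)
        (cong₂ _,_ (cong (proj₁ ∘ proj₂) eq₀)
                   (𝒱-ℬ l (proj₁ (nbr u i)) (proj₁ (nbr v j)) (cong (proj₂ ∘ proj₂) eq₀))))
      (truncate is js eqs)

  distinctB⇒feasible : ∀ r → DistinctB G r → Feasible G
  distinctB⇒feasible r dist u v u≢v = suc r , λ eq → u≢v (dist u v (𝒱-ℬ r u v eq))

-- Graphs on arbitrary finite vertex types.

∑ : ∀ n → (Fin n → ℕ) → ℕ
∑ zero    k = 0
∑ (suc n) k = k zero + ∑ n (k ∘ suc)

encode : ∀ n (k : Fin n → ℕ) → Σ (Fin n) (Fin ∘ k) → Fin (∑ n k)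
encode (suc n) k (zero  , j) = j ↑ˡ _
encode (suc n) k (suc x , j) = k zero ↑ʳ encode n (k ∘ suc) (x , j)

decode : ∀ n (k : Fin n → ℕ) → Fin (∑ n k) → Σ (Fin n) (Fin ∘ k)
decode (suc n) k i with splitAt (k zero) i
... | inj₁ j  = zero , j
... | inj₂ i′ with decode n (k ∘ suc) i′
... | x , j = suc x , j

decode-encode : ∀ n k v → decode n k (encode n k v) ≡ v
decode-encode (suc n) k (zero  , j) rewrite Fin.splitAt-↑ˡ (k zero) j (∑ n (k ∘ suc)) = refl
decode-encode (suc n) k (suc x , j)
  rewrite Fin.splitAt-↑ʳ (k zero) (∑ n (k ∘ suc)) (encode n (k ∘ suc) (x , j))
        | decode-encode n (k ∘ suc) (x , j) = refl

encode-decode : ∀ n k i → encode n k (decode n k i) ≡ i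
encode-decode (suc n) k i with splitAt (k zero) i in eq
... | inj₁ j  = Fin.splitAt⁻¹-↑ˡ eq
... | inj₂ i′ with decode n (k ∘ suc) i′ in eq′
... | x , j = trans (cong (λ v → k zero ↑ʳ encode n (k ∘ suc) v) (sym eq′))
                    (trans (cong (k zero ↑ʳ_) (encode-decode n (k ∘ suc) i′))
                           (Fin.splitAt⁻¹-↑ʳ eq))

n≤∑ : ∀ n {k : Fin n → ℕ} → (∀ x → 1 ≤ k x) → n ≤ ∑ n k
n≤∑ zero    k≥1 = z≤n
n≤∑ (suc n) k≥1 = +-mono-≤ (k≥1 zero) (n≤∑ n (k≥1 ∘ suc))

Σ-toℕ-≡ : ∀ {A : Set} {d : A → ℕ} {a a′ : A} {p : Fin (d a)} {p′ : Fin (d a′)} →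
          a ≡ a′ → toℕ p ≡ toℕ p′ → _≡_ {A = Σ A (Fin ∘ d)} (a , p) (a′ , p′)
Σ-toℕ-≡ refl eq = cong (_ ,_) (Fin.toℕ-injective eq)

-- Lets the rings below use dependent pairs as vertices; `graph` transports the structure along the
-- bijection with `Fin size`.
record FiniteGraph : Set₁ where
  field
    V        : Set
    size     : ℕ
    enc      : V → Fin size
    dec      : Fin size → V
    dec-enc  : ∀ v → dec (enc v) ≡ v
    enc-dec  : ∀ i → enc (dec i) ≡ i
    deg      : V → ℕ
    nbr      : (v : V) → Fin (deg v) → Σ V (Fin ∘ deg)

  Edge : Set
  Edge = Σ V (Fin ∘ deg)

  -- `dec (enc u)` equals `u` only propositionally, so ports must be transported; their numbers,
  -- which are all that views record, do not change.
  reindexPort : ∀ {u u′} → u′ ≡ u → Fin (deg u) → Fin (deg u′)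
  reindexPort eq = subst (Fin ∘ deg) (sym eq)

  toℕ-reindexPort : ∀ {u u′} (eq : u′ ≡ u) (q : Fin (deg u)) → toℕ (reindexPort eq q) ≡ toℕ q
  toℕ-reindexPort refl q = refl

  encodeEdge : Edge → Σ (Fin size) (Fin ∘ deg ∘ dec)
  encodeEdge (u , q) = enc u , reindexPort (dec-enc u) q

  graph : Graph
  graph = record
    { n   = size
    ; deg = deg ∘ dec
    ; nbr = λ i p → encodeEdge (nbr (dec i) p)
    }

  nbr-encodeEdge : ∀ u q → encodeEdge (nbr (dec (enc u)) (reindexPort (dec-enc u) q))
                         ≡ encodeEdge (nbr u q)
  nbr-encodeEdge u q = along (dec-enc u)
    where
    along : ∀ {u′} (eq : u′ ≡ u) → encodeEdge (nbr u′ (reindexPort eq q)) ≡ encodeEdge (nbr u q)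
    along refl = refl

  encodeEdge-dec : ∀ i (p : Fin (deg (dec i))) → encodeEdge (dec i , p) ≡ (i , p)
  encodeEdge-dec i p = Σ-toℕ-≡ (enc-dec i) (toℕ-reindexPort (dec-enc (dec i)) p)

  adjacent : ∀ u (p : Fin (deg u)) → Adj graph (enc u) (enc (proj₁ (nbr u p)))
  adjacent u p = reindexPort (dec-enc u) p , cong proj₁ (nbr-encodeEdge u p)

  𝒯 : ℕ → V → View
  𝒯 zero    v = leaf (deg v)
  𝒯 (suc l) v = node (map (λ i → toℕ i , toℕ (proj₂ (nbr v i)) , 𝒯 l (proj₁ (nbr v i)))
                          (allFin (deg v)))

  ℬ≡𝒯 : ∀ l i → ℬ graph l i ≡ 𝒯 l (dec i)
  ℬ≡𝒯 zero    i = refl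
  ℬ≡𝒯 (suc l) i = cong node (map-cong child (allFin (deg (dec i))))
    where
    child : ∀ p → let (u , q) = nbr (dec i) p in
            (toℕ p , toℕ (reindexPort (dec-enc u) q) , ℬ graph l (enc u)) ≡ (toℕ p , toℕ q , 𝒯 l u)
    child p = let (u , q) = nbr (dec i) p in
      cong₂ (λ a t → toℕ p , a , t) (toℕ-reindexPort (dec-enc u) q)
            (trans (ℬ≡𝒯 l (enc u)) (cong (𝒯 l) (dec-enc u)))

  distinct𝒯⇒distinctB : ∀ l → (∀ u v → 𝒯 l u ≡ 𝒯 l v → u ≡ v) → DistinctB graph l
  distinct𝒯⇒distinctB l dist i j eq =
    trans (sym (enc-dec i)) (trans (cong enc (dist _ _
      (trans (sym (ℬ≡𝒯 l i)) (trans eq (ℬ≡𝒯 l j))))) (enc-dec j))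

  module _ (nbr-nbr : ∀ v i → nbr (proj₁ (nbr v i)) (proj₂ (nbr v i)) ≡ (v , i))
           (noLoop : ∀ v i → proj₁ (nbr v i) ≢ v)
           (noMulti : ∀ v i i′ → proj₁ (nbr v i) ≡ proj₁ (nbr v i′) → i ≡ i′) where

    private
      enc-injective : ∀ {u v} → enc u ≡ enc v → u ≡ v
      enc-injective {u} {v} eq = trans (sym (dec-enc u)) (trans (cong dec eq) (dec-enc v))

    graph-isGraph : 3 ≤ size → Connected graph → IsGraph graph
    graph-isGraph 3≤ conn = record
      { three≤n   = 3≤
      ; symmetric = λ { v i _ _ refl → let (u , q) = nbr (dec v) i in
          trans (nbr-encodeEdge u q)
                (trans (cong encodeEdge (nbr-nbr (dec v) i)) (encodeEdge-dec v i)) }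
      ; noLoop    = λ v i eq → noLoop (dec v) i
          (trans (sym (dec-enc _)) (cong dec eq))
      ; noMulti   = λ v i i′ eq → noMulti (dec v) i i′ (enc-injective eq)
      ; connected = conn
      }

-- Congruences modulo the period.

module _ (n : ℕ) .{{_ : NonZero n}} where

  %-+-congʳ : ∀ x y z → x % n ≡ y % n → (x + z) % n ≡ (y + z) % n
  %-+-congʳ x y z eq = begin
    (x + z) % n             ≡⟨ %-distribˡ-+ x z n ⟩
    (x % n + z % n) % n     ≡⟨ cong (λ a → (a + z % n) % n) eq ⟩
    (y % n + z % n) % n     ≡⟨ %-distribˡ-+ y z n ⟨
    (y + z) % n             ∎
    where open ≡-Reasoning

  [m%n+o]%n≡[m+o]%n : ∀ x z → (x % n + z) % n ≡ (x + z) % n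
  [m%n+o]%n≡[m+o]%n x z = %-+-congʳ (x % n) x z (m%n%n≡m%n x n)

-- Adding `z * m` to both sides completes `z` to the multiple `z * suc m` of the modulus, which
-- avoids subtraction.
%-+-cancelʳ : ∀ n .{{_ : NonZero n}} x y z → (x + z) % n ≡ (y + z) % n → x % n ≡ y % n
%-+-cancelʳ (suc m) x y z eq = begin
  x % suc m                   ≡⟨ complete x ⟨
  (x + z + z * m) % suc m     ≡⟨ %-+-congʳ (suc m) (x + z) (y + z) (z * m) eq ⟩
  (y + z + z * m) % suc m     ≡⟨ complete y ⟩
  y % suc m                   ∎
  where
  open ≡-Reasoning
  complete : ∀ w → (w + z + z * m) % suc m ≡ w % suc m
  complete w = trans (cong (_% suc m) (regroup w z m)) ([m+kn]%n≡m%n w z (suc m))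
    where
    regroup : ∀ w z m → w + z + z * m ≡ w + z * suc m
    regroup = solve-∀

-- Views along the unrolled line.

-- The view of the core at position x of the bi-infinite line obtained by
-- unrolling a ring; only positions ≥ 0 exist here, so it is meaningful for
-- depths l ≤ x.
mutual
  coreView : (ℕ → ℕ) → ℕ → ℕ → View
  coreView f zero    x = leaf (2 + f x)
  coreView f (suc l) x = node ((0 , 1 , coreView f l (suc x)) ∷ (1 , 0 , coreView f l (pred x)) ∷
    tabulate {n = f x} (λ k → 2 + toℕ k , 0 , pendantView f l x (toℕ k)))

  pendantView : (ℕ → ℕ) → ℕ → ℕ → ℕ → View
  pendantView f zero    x k = leaf 1
  pendantView f (suc l) x k = node ((0 , 2 + k , coreView f l x) ∷ [])

tabulate-≡ : ∀ {A : Set} {m n} (t : ℕ → A) (t′ : ℕ → A) → m ≡ n → (∀ k → t k ≡ t′ k) →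
             tabulate {n = m} (t ∘ toℕ) ≡ tabulate {n = n} (t′ ∘ toℕ)
tabulate-≡ t t′ refl eq = tabulate-cong (eq ∘ toℕ)

mutual
  -- Information travels one position per round, so only labels at distance at most `l` matter. The
  -- two offsets compare copies of one stretch of labels at different places of two words; `l ≤ x`
  -- keeps `pred` from being applied at 0.
  coreView-local : ∀ {f g : ℕ → ℕ} o c l x → l ≤ x →
    (∀ i → x ≤ i + l → i ≤ x + l → g (o + i) ≡ f (c + i)) →
    coreView g l (o + x) ≡ coreView f l (c + x)
  coreView-local o c zero x _ agree =
    cong (leaf ∘ (2 +_)) (agree x (m≤m+n x 0) (m≤m+n x 0))
  coreView-local {f} {g} o c (suc l) (suc x) (s≤s l≤x) agree = cong node (cong₂ _∷_
    (cong (λ t → 0 , 1 , t) (subst₂ (λ a b → coreView g l a ≡ coreView f l b)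
      (+-suc o (suc x)) (+-suc c (suc x))
      (coreView-local o c l (2 + x) (m≤n⇒m≤o+n 2 l≤x) λ i p q →
        agree i (≤-trans (s≤s (n≤1+n x)) (≤-trans p (+-monoʳ-≤ i (n≤1+n l))))
                (≤-trans q (≤-reflexive (sym (+-suc (suc x) l)))))))
    (cong₂ _∷_ (cong (λ t → 1 , 0 , t) (subst₂ (λ a b → coreView g l a ≡ coreView f l b)
      (cong pred (sym (+-suc o x))) (cong pred (sym (+-suc c x)))
      (coreView-local o c l x l≤x λ i p q →
        agree i (≤-trans (s≤s p) (≤-reflexive (sym (+-suc i l))))
                (≤-trans q (+-mono-≤ (n≤1+n x) (n≤1+n l))))))
    (tabulate-≡ (λ k → 2 + k , 0 , pendantView g l (o + suc x) k)
                (λ k → 2 + k , 0 , pendantView f l (c + suc x) k)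
      (agree (suc x) (m≤m+n _ _) (m≤m+n _ _))
      λ k → cong (λ t → 2 + k , 0 , t)
        (pendantView-local o c l (suc x) k (m≤n⇒m≤1+n l≤x) λ i p q →
          agree i (≤-trans p (+-monoʳ-≤ i (n≤1+n l))) (≤-trans q (+-monoʳ-≤ (suc x) (n≤1+n l)))))))

  pendantView-local : ∀ {f g : ℕ → ℕ} o c l x k → l ≤ x →
    (∀ i → x ≤ i + l → i ≤ x + l → g (o + i) ≡ f (c + i)) →
    pendantView g l (o + x) k ≡ pendantView f l (c + x) k
  pendantView-local o c zero    x k _ _ = refl
  pendantView-local o c (suc l) x k l<x agree = cong (λ t → node ((0 , 2 + k , t) ∷ []))
    (coreView-local o c l x (<⇒≤ l<x) λ i p q →
      agree i (≤-trans p (+-monoʳ-≤ i (n≤1+n l))) (≤-trans q (+-monoʳ-≤ x (n≤1+n l))))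

module _ (f : ℕ → ℕ) where

  coreView-label : ∀ l x y → coreView f l x ≡ coreView f l y → f x ≡ f y
  coreView-label zero    x y eq = suc-injective (suc-injective (leaf-injective eq))
    where
    leaf-injective : ∀ {m n} → leaf m ≡ leaf n → m ≡ n
    leaf-injective refl = refl
  coreView-label (suc l) x y eq = begin
    f x                ≡⟨ length-tabulate {n = f x} _ ⟨
    length (tabulate {n = f x} _)
      ≡⟨ cong length (proj₂ (∷-injective (proj₂ (∷-injective (node-injective eq))))) ⟩
    length (tabulate {n = f y} _) ≡⟨ length-tabulate {n = f y} _ ⟩
    f y                ∎
    where open ≡-Reasoning

  coreView-next : ∀ l x y → coreView f (suc l) x ≡ coreView f (suc l) y →
                  coreView f l (suc x) ≡ coreView f l (suc y)
  coreView-next l x y eq = cong (proj₂ ∘ proj₂) (proj₁ (∷-injective (node-injective eq)))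

  coreView-prev : ∀ l x y → coreView f (suc l) x ≡ coreView f (suc l) y →
                  coreView f l (pred x) ≡ coreView f l (pred y)
  coreView-prev l x y eq =
    cong (proj₂ ∘ proj₂) (proj₁ (∷-injective (proj₂ (∷-injective (node-injective eq)))))

  -- Moving to a neighbour of the centre costs one level of depth. The first two labels of the
  -- window are reached through the predecessor (or are the centre itself), the others through the
  -- successor, whose window starts two positions later.
  coreView-window : ∀ r x y → coreView f r (x + r) ≡ coreView f r (y + r) →
                    ∀ j → j ≤ r + r → f (x + j) ≡ f (y + j)
  coreView-window zero    x y eq zero _ = coreView-label 0 _ _ eq
  coreView-window (suc r) x y eq zero _ =
    coreView-window r x y
      (coreView-prev r _ _ (subst₂ (λ a b → coreView f (suc r) a ≡ coreView f (suc r) b)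
                                   (+-suc x r) (+-suc y r) eq))
      0 z≤n
  coreView-window (suc zero) x y eq (suc zero) _ = coreView-label 1 _ _ eq
  coreView-window (suc (suc r)) x y eq (suc zero) _ =
    coreView-window (suc r) x y
      (coreView-prev (suc r) _ _ (subst₂ (λ a b → coreView f (2 + r) a ≡ coreView f (2 + r) b)
                                         (+-suc x (suc r)) (+-suc y (suc r)) eq))
      1 (s≤s z≤n)
  coreView-window (suc r) x y eq (suc (suc j)) (s≤s j<) =
    subst₂ (λ a b → f a ≡ f b) (shift x j) (shift y j)
      (coreView-window r (2 + x) (2 + y)
        (subst₂ (λ a b → coreView f r a ≡ coreView f r b) (cong suc (+-suc x r)) (cong suc (+-suc y r))
          (coreView-next r _ _ eq))
        j (s≤s⁻¹ (≤-trans j< (≤-reflexive (+-suc r r)))))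
    where
    shift : ∀ x j → 2 + x + j ≡ x + (2 + j)
    shift = solve-∀

-- Periodic words and their rings.

-- The period is odd so that the core opposite to the seam sees equally far in
-- both directions.
record Word : Set where
  field
    h        : ℕ
    f        : ℕ → ℕ
    1≤h      : 1 ≤ h
    periodic : ∀ x → f (x % suc (h + h)) ≡ f x

  m n : ℕ
  m = h + h
  n = suc m

  f-cong : ∀ x y → x % n ≡ y % n → f x ≡ f y
  f-cong x y eq = trans (sym (periodic x)) (trans (cong f eq) (periodic y))

  -- Stands in for the election index: a window of radius `r` determines its position in the period.
  -- Windows are given by their left end, so that no subtraction occurs.
  Resolves : ℕ → Set
  Resolves r = ∀ x y → (∀ j → j ≤ r + r → f (x + j) ≡ f (y + j)) → x % n ≡ y % n

  resolves-mono : ∀ {r s} → r ≤ s → Resolves r → Resolves s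
  resolves-mono r≤s res x y eq = res x y λ j j≤ → eq j (≤-trans j≤ (+-mono-≤ r≤s r≤s))

  toℕ-mod : ∀ x → toℕ (x mod n) ≡ x % n
  toℕ-mod x = Fin.toℕ-fromℕ< (m%n<n x n)

  mod-cong : ∀ x y → x % n ≡ y % n → x mod n ≡ y mod n
  mod-cong x y eq = Fin.toℕ-injective (trans (toℕ-mod x) (trans eq (sym (toℕ-mod y))))

  toℕ%n : ∀ (x : Fin n) → toℕ x % n ≡ toℕ x
  toℕ%n x = m<n⇒m%n≡m (Fin.toℕ<n x)

  mod-toℕ : ∀ (x : Fin n) → toℕ x mod n ≡ x
  mod-toℕ x = Fin.toℕ-injective (trans (toℕ-mod (toℕ x)) (toℕ%n x))

  -- Adding `m` is subtracting one modulo `n`.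
  next prev : Fin n → Fin n
  next x = suc (toℕ x) mod n
  prev x = (toℕ x + m) mod n

  next-mod : ∀ x → next (x mod n) ≡ suc x mod n
  next-mod x = mod-cong (suc (toℕ (x mod n))) (suc x) (begin
    suc (toℕ (x mod n)) % n ≡⟨ cong (_% n) (trans (cong suc (toℕ-mod x)) (+-comm 1 (x % n))) ⟩
    (x % n + 1) % n         ≡⟨ [m%n+o]%n≡[m+o]%n n x 1 ⟩
    (x + 1) % n             ≡⟨ cong (_% n) (+-comm x 1) ⟩
    suc x % n               ∎)
    where open ≡-Reasoning

  prev-mod : ∀ x → prev (suc x mod n) ≡ x mod n
  prev-mod x = mod-cong (toℕ (suc x mod n) + m) x (begin
    (toℕ (suc x mod n) + m) % n ≡⟨ cong (λ a → (a + m) % n) (toℕ-mod (suc x)) ⟩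
    (suc x % n + m) % n         ≡⟨ [m%n+o]%n≡[m+o]%n n (suc x) m ⟩
    (suc x + m) % n             ≡⟨ cong (_% n) (sym (+-suc x m)) ⟩
    (x + n) % n                 ≡⟨ [m+n]%n≡m%n x n ⟩
    x % n                       ∎)
    where open ≡-Reasoning

  prev-next : ∀ x → prev (next x) ≡ x
  prev-next x = trans (prev-mod (toℕ x)) (mod-toℕ x)

  next-prev : ∀ x → next (prev x) ≡ x
  next-prev x = begin
    next (prev x)           ≡⟨ next-mod (toℕ x + m) ⟩
    suc (toℕ x + m) mod n   ≡⟨ mod-cong (suc (toℕ x + m)) (toℕ x)
                                 (trans (cong (_% n) (sym (+-suc (toℕ x) m))) ([m+n]%n≡m%n (toℕ x) n)) ⟩
    toℕ x mod n             ≡⟨ mod-toℕ x ⟩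
    x                       ∎
    where open ≡-Reasoning

  private
    -- The period is at least 3, which makes a core and its two neighbours on the cycle pairwise
    -- distinct.
    1<m : 1 < m
    1<m = +-mono-≤ 1≤h 1≤h

    small : ∀ {a b} → a < n → b < n → (x : Fin n) → (a + toℕ x) % n ≡ (b + toℕ x) % n → a ≡ b
    small {a} {b} a< b< x eq =
      trans (sym (m<n⇒m%n≡m a<)) (trans (%-+-cancelʳ n a b (toℕ x) eq) (m<n⇒m%n≡m b<))

    mod-injective : ∀ x y → x mod n ≡ y mod n → x % n ≡ y % n
    mod-injective x y eq = trans (sym (toℕ-mod x)) (trans (cong toℕ eq) (toℕ-mod y))

  next≢ : ∀ x → next x ≢ x
  next≢ x eq = 1+n≢0 (small (s≤s (<⇒≤ 1<m)) z<s x
    (mod-injective (suc (toℕ x)) (toℕ x) (trans eq (sym (mod-toℕ x)))))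

  prev≢ : ∀ x → prev x ≢ x
  prev≢ x eq = m<n⇒n≢0 1<m (small ≤-refl z<s x
    (trans (cong (_% n) (+-comm m (toℕ x)))
           (mod-injective (toℕ x + m) (toℕ x) (trans eq (sym (mod-toℕ x))))))

  next≢prev : ∀ x → next x ≢ prev x
  next≢prev x eq = <⇒≢ 1<m (small (s≤s (<⇒≤ 1<m)) ≤-refl x
    (trans (mod-injective (1 + toℕ x) (toℕ x + m) eq) (cong (_% n) (+-comm (toℕ x) m))))

  -- The vertex (x , 0) is the core at x; (x , 1 + k) is its k-th pendant leaf.
  fibre : Fin n → ℕ
  fibre x = suc (f (toℕ x))

  Vertex : Set
  Vertex = Σ (Fin n) (Fin ∘ fibre)

  degree : Vertex → ℕ
  degree (x , zero)  = 2 + f (toℕ x)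
  degree (x , suc _) = 1

  -- Port 0 of every core points forward and arrives at port 1, so the ports on the cycle carry no
  -- information and only the labels can break symmetry.
  neighbour : (v : Vertex) → Fin (degree v) → Σ Vertex (Fin ∘ degree)
  neighbour (x , zero)  zero          = (next x , zero) , suc zero
  neighbour (x , zero)  (suc zero)    = (prev x , zero) , zero
  neighbour (x , zero)  (suc (suc k)) = (x , suc k) , zero
  neighbour (x , suc k) zero          = (x , zero) , suc (suc k)

  ring : FiniteGraph
  ring = record
    { V       = Vertex
    ; size    = ∑ n fibre
    ; enc     = encode n fibre
    ; dec     = decode n fibre
    ; dec-enc = decode-encode n fibre
    ; enc-dec = encode-decode n fibre
    ; deg     = degree
    ; nbr     = neighbour
    }

  open FiniteGraph ring public using (graph; enc; dec; 𝒯; ℬ≡𝒯)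
  open FiniteGraph ring using (dec-enc; enc-dec; adjacent; graph-isGraph; distinct𝒯⇒distinctB)

  core : ℕ → Vertex
  core x = x mod n , zero

  core-mod : ∀ (x : Fin n) → core (toℕ x) ≡ (x , zero)
  core-mod x = cong (_, zero) (mod-toℕ x)

  f-mod : ∀ x → f (toℕ (x mod n)) ≡ f x
  f-mod x = trans (cong f (toℕ-mod x)) (periodic x)

  private
    neighbour-neighbour : ∀ v i → neighbour (proj₁ (neighbour v i)) (proj₂ (neighbour v i)) ≡ (v , i)
    neighbour-neighbour (x , zero)  zero          = Σ-toℕ-≡ (cong (_, zero) (prev-next x)) refl
    neighbour-neighbour (x , zero)  (suc zero)    = Σ-toℕ-≡ (cong (_, zero) (next-prev x)) refl
    neighbour-neighbour (x , zero)  (suc (suc k)) = refl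
    neighbour-neighbour (x , suc k) zero          = refl

    loopless : ∀ v i → proj₁ (neighbour v i) ≢ v
    loopless (x , zero)  zero          eq = next≢ x (cong proj₁ eq)
    loopless (x , zero)  (suc zero)    eq = prev≢ x (cong proj₁ eq)
    loopless (x , zero)  (suc (suc k)) ()
    loopless (x , suc k) zero          ()

    slot : Vertex → ℕ
    slot (x , k) = toℕ k

    multifree : ∀ v i i′ → proj₁ (neighbour v i) ≡ proj₁ (neighbour v i′) → i ≡ i′
    multifree (x , suc k) zero zero _ = refl
    multifree (x , zero) zero zero _ = refl
    multifree (x , zero) zero (suc zero) eq = ⊥-elim (next≢prev x (cong proj₁ eq))
    multifree (x , zero) (suc zero) zero eq = ⊥-elim (next≢prev x (sym (cong proj₁ eq)))
    multifree (x , zero) (suc zero) (suc zero) _ = refl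
    multifree (x , zero) zero (suc (suc k)) eq with cong slot eq
    ... | ()
    multifree (x , zero) (suc zero) (suc (suc k)) eq with cong slot eq
    ... | ()
    multifree (x , zero) (suc (suc k)) zero eq with cong slot eq
    ... | ()
    multifree (x , zero) (suc (suc k)) (suc zero) eq with cong slot eq
    ... | ()
    multifree (x , zero) (suc (suc k)) (suc (suc k′)) eq =
      cong suc (Fin.toℕ-injective (cong slot eq))

    Path : ℕ → Vertex → Vertex → Set
    Path k u v = Within graph k (enc u) (enc v)

    edge : ∀ u (p : Fin (degree u)) {v} → proj₁ (neighbour u p) ≡ v → Path 1 u v
    edge u p refl = step (adjacent u p) here

    forward : ∀ k x → Path k (core x) (core (k + x))
    forward zero    x = here
    forward (suc k) x = subst (λ a → Path (suc k) (core x) (core a)) (+-suc k x)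
      (within-trans graph {k = 1} (edge (core x) zero (cong (_, zero) (next-mod x))) (forward k (suc x)))

    backward : ∀ k x → Path k (core (k + x)) (core x)
    backward zero    x = here
    backward (suc k) x = within-trans graph {k = 1}
      (edge (core (suc k + x)) (suc zero) (cong (_, zero) (prev-mod (k + x)))) (backward k x)

    -- The two arcs between a pair of positions have total length `2 h + 1`, so one of them has
    -- length at most `h`.
    around : ∀ {a b} → a ≤ b → b < n → Path h (core a) (core b) × Path h (core b) (core a)
    around {a} {b} a≤b b<n with m≤n⇒∃[o]m+o≡n a≤b
    ... | d , refl with d ≤? h
    ... | yes d≤h = within-mono graph d≤h (subst (λ y → Path d (core a) (core y)) (+-comm d a) (forward d a))
                  , within-mono graph d≤h (subst (λ y → Path d (core y) (core a)) (+-comm d a) (backward d a))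
    ... | no d≰h with m≤n⇒∃[o]m+o≡n (≤-trans (m≤n+m d a) (<⇒≤ b<n))
    ... | e , d+e≡n =
          within-mono graph e≤h (subst (λ y → Path e y (core (a + d))) wrap (backward e (a + d)))
        , within-mono graph e≤h (subst (λ y → Path e (core (a + d)) y) wrap (forward e (a + d)))
      where
      regroup : ∀ e a d → e + (a + d) ≡ a + (d + e)
      regroup = solve-∀
      wrap : core (e + (a + d)) ≡ core a
      wrap = cong (_, zero) (mod-cong (e + (a + d)) a
        (trans (cong (_% n) (trans (regroup e a d) (cong (a +_) d+e≡n))) ([m+n]%n≡m%n a n)))
      e≤h : e ≤ h
      e≤h = +-cancelˡ-≤ (suc h) e h (≤-trans (+-monoˡ-≤ e (≰⇒> d≰h)) (≤-reflexive d+e≡n))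

    core-core : ∀ (x y : Fin n) → Path h (x , zero) (y , zero)
    core-core x y with ≤-total (toℕ x) (toℕ y)
    ... | inj₁ x≤y = subst₂ (Path h) (core-mod x) (core-mod y) (proj₁ (around x≤y (Fin.toℕ<n y)))
    ... | inj₂ y≤x = subst₂ (Path h) (core-mod x) (core-mod y) (proj₂ (around y≤x (Fin.toℕ<n x)))

    core-any : ∀ x v → Path (h + 1) (x , zero) v
    core-any x (y , zero)  = within-mono graph (m≤m+n h 1) (core-core x y)
    core-any x (y , suc k) = within-trans graph (core-core x y) (edge (y , zero) (suc (suc k)) refl)

    any-any : ∀ u v → Path (suc (h + 1)) u v
    any-any (x , zero)  v = within-mono graph (n≤1+n _) (core-any x v)
    any-any (x , suc k) v = within-trans graph {k = 1} (edge (x , suc k) zero refl) (core-any x v)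

  -- Two cores are at distance at most `h`, and each pendant endpoint costs one more edge; hence the
  -- diameter is at most `h + 2`.
  graph-within : ∀ u v → Within graph (suc (h + 1)) u v
  graph-within u v = subst₂ (Within graph _) (enc-dec u) (enc-dec v) (any-any (dec u) (dec v))

  isGraph : IsGraph graph
  isGraph = graph-isGraph neighbour-neighbour loopless multifree
    (≤-trans (s≤s 1<m) (n≤∑ n {fibre} (λ _ → s≤s z≤n))) (_ , graph-within)

  mutual
    𝒯-core : ∀ l x → l ≤ x → 𝒯 l (core x) ≡ coreView f l x
    𝒯-core zero    x _ = cong (leaf ∘ (2 +_)) (f-mod x)
    𝒯-core (suc l) (suc x) (s≤s l≤x) = cong node (cong₂ _∷_
      (cong (λ t → 0 , 1 , t)
        (trans (cong (λ y → 𝒯 l (y , zero)) (next-mod (suc x))) (𝒯-core l (2 + x) (m≤n⇒m≤o+n 2 l≤x))))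
      (cong₂ _∷_
        (cong (λ t → 1 , 0 , t) (trans (cong (λ y → 𝒯 l (y , zero)) (prev-mod x)) (𝒯-core l x l≤x)))
        (trans (map-tabulate {n = f (toℕ (suc x mod n))} (λ k → suc (suc k)) _)
          (trans (tabulate-cong (λ k → cong (λ t → 2 + toℕ k , 0 , t)
                                       (𝒯-pendant l (suc x) (m≤n⇒m≤1+n l≤x) k)))
                 (tabulate-≡ (λ k → 2 + k , 0 , pendantView f l (suc x) k)
                             (λ k → 2 + k , 0 , pendantView f l (suc x) k)
                             (f-mod (suc x)) (λ _ → refl))))))

    𝒯-pendant : ∀ l x → l ≤ x → (k : Fin (f (toℕ (x mod n)))) →
                𝒯 l (x mod n , suc k) ≡ pendantView f l x (toℕ k)
    𝒯-pendant zero    x _   k = refl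
    𝒯-pendant (suc l) x l<x k = cong (λ t → node ((0 , 2 + toℕ k , t) ∷ [])) (𝒯-core l x (<⇒≤ l<x))

  ℬ-core : ∀ l x → l ≤ x → ℬ graph l (enc (core x)) ≡ coreView f l x
  ℬ-core l x l≤x = trans (ℬ≡𝒯 l _) (trans (cong (𝒯 l) (dec-enc (core x))) (𝒯-core l x l≤x))

  private
    first : ∀ {a b as bs} → node (a ∷ as) ≡ node (b ∷ bs) → a ≡ b
    first refl = refl

    core-resolves : ∀ {r} → Resolves r → ∀ x y → 𝒯 r (x , zero) ≡ 𝒯 r (y , zero) → x ≡ y
    core-resolves {r} res x y eq = trans (sym (at-mod x)) (trans
      (mod-cong (at x) (at y) (%-+-congʳ n (lift x) (lift y) r
        (res (lift x) (lift y) (coreView-window f r (lift x) (lift y)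
          (trans (sym (𝒯-at x)) (trans eq (𝒯-at y)))))))
      (at-mod y))
      where
      lift at : Fin n → ℕ
      -- The window starting at `lift x` has its centre at `toℕ x + r * n`, which represents `x` and
      -- lies far enough from 0 for a view of depth `r`.
      lift x = toℕ x + r * m
      at x = lift x + r

      at-mod : ∀ x → at x mod n ≡ x
      at-mod x = trans
        (mod-cong (at x) (toℕ x) (trans (cong (_% n) (regroup (toℕ x) r m)) ([m+kn]%n≡m%n (toℕ x) r n)))
        (mod-toℕ x)
        where
        regroup : ∀ x r m → x + r * m + r ≡ x + r * suc m
        regroup = solve-∀

      𝒯-at : ∀ x → 𝒯 r (x , zero) ≡ coreView f r (at x)
      𝒯-at x = trans (cong (λ y → 𝒯 r (y , zero)) (sym (at-mod x))) (𝒯-core r (at x) (m≤n+m r _))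

  -- The extra round serves the pendant leaves: a leaf at depth `r + 1` sees its core at depth `r`,
  -- and the port at the core tells apart the leaves of one core. Leaves and cores differ in their
  -- number of children.
  resolves⇒distinctB : ∀ {r} → Resolves r → DistinctB graph (suc r)
  resolves⇒distinctB {r} res = distinct𝒯⇒distinctB (suc r) distinct
    where
    distinct : ∀ u v → 𝒯 (suc r) u ≡ 𝒯 (suc r) v → u ≡ v
    distinct (x , zero)  (y , zero)  eq =
      cong (_, zero) (core-resolves (resolves-mono (n≤1+n r) res) x y eq)
    distinct (x , zero)  (y , suc j) ()
    distinct (x , suc k) (y , zero)  ()
    distinct (x , suc k) (y , suc j) eq =
      Σ-toℕ-≡ (core-resolves res x y (cong (proj₂ ∘ proj₂) (first eq)))
              (suc-injective (cong (proj₁ ∘ proj₂) (first eq)))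

-- Positions along walks.

module _ (W : Word) where
  open Word W

  coordinate : Fin (Graph.n graph) → ℕ
  coordinate i = toℕ (proj₁ (dec i))

  private
    toℕ-prev : ∀ x c → toℕ x ≡ suc c → toℕ (prev x) ≡ c
    toℕ-prev x c eq = begin
      toℕ (prev x)       ≡⟨ toℕ-mod (toℕ x + m) ⟩
      (toℕ x + m) % n    ≡⟨ cong (λ a → (a + m) % n) eq ⟩
      (suc c + m) % n    ≡⟨ cong (_% n) (sym (+-suc c m)) ⟩
      (c + n) % n        ≡⟨ [m+n]%n≡m%n c n ⟩
      c % n              ≡⟨ m<n⇒m%n≡m (<-trans (≤-reflexive (sym eq)) (Fin.toℕ<n x)) ⟩
      c                  ∎
      where open ≡-Reasoning

    near : ∀ v p → 1 ≤ toℕ (proj₁ v) → suc (toℕ (proj₁ v)) < n →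
           let c = toℕ (proj₁ v) ; c′ = toℕ (proj₁ (proj₁ (neighbour v p))) in
           c′ ≤ suc c × c ≤ suc c′
    near (x , zero) zero 1≤c c<n rewrite toℕ-mod (suc (toℕ x)) | m<n⇒m%n≡m c<n =
      ≤-refl , m≤n⇒m≤1+n (n≤1+n _)
    near (x , zero) (suc zero) 1≤c c<n with m≤n⇒∃[o]m+o≡n 1≤c
    ... | c , eq = subst₂ (λ a a′ → a′ ≤ suc a × a ≤ suc a′) eq (sym (toℕ-prev x c (sym eq)))
      (m≤n⇒m≤1+n (n≤1+n c) , ≤-refl)
    near (x , zero)  (suc (suc k)) _ _ = n≤1+n _ , n≤1+n _
    near (x , suc k) zero          _ _ = n≤1+n _ , n≤1+n _

  coordinate-enc : ∀ v → coordinate (enc v) ≡ toℕ (proj₁ v)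
  coordinate-enc v = cong (toℕ ∘ proj₁) (dec-enc v)
    where open FiniteGraph ring using (dec-enc)

  -- Away from the seam between positions `n - 1` and 0, an edge changes the coordinate by at most
  -- one. The two bounds on `length ps` keep the walk from crossing that seam.
  walk-near : ∀ {v ps w vs} → Walk graph v ps w vs →
    length ps ≤ coordinate v → coordinate v + length ps < n →
    coordinate w ≤ coordinate v + length ps × coordinate v ≤ coordinate w + length ps
  walk-near stop _ _ = m≤m+n _ 0 , m≤m+n _ 0
  walk-near {v} {_ ∷ ps} {w} (go i rest) l≤c c+l<n =
    ≤-trans (proj₁ ih) (≤-trans (+-monoˡ-≤ l (proj₁ c′-near)) (≤-reflexive (sym (+-suc c l)))) ,
    ≤-trans (proj₂ c′-near) (≤-trans (s≤s (proj₂ ih)) (≤-reflexive (sym (+-suc (coordinate w) l))))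
    where
    c c′ l : ℕ
    c  = coordinate v
    c′ = coordinate (proj₁ (Graph.nbr graph v i))
    l  = length ps
    sc+l<n : suc c + l < n
    sc+l<n = subst (_< n) (+-suc c l) c+l<n
    c′-near : c′ ≤ suc c × c ≤ suc c′
    c′-near = subst (λ a → a ≤ suc c × c ≤ suc a) (sym (coordinate-enc _))
      (near (dec v) i (≤-trans (s≤s z≤n) l≤c) (≤-<-trans (m≤m+n (suc c) l) sc+l<n))
    ih : coordinate w ≤ c′ + l × c′ ≤ coordinate w + l
    ih = walk-near rest (s≤s⁻¹ (≤-trans l≤c (proj₂ c′-near)))
                        (≤-<-trans (+-monoˡ-≤ l (proj₁ c′-near)) sc+l<n)

-- Decisions and conflicts.

module _ (A : DistAlg) (a : List Bool) where

  -- The counterpart of `OutputsAt` on the unrolled line. It mentions labels only, so it can be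
  -- carried from one word to another.
  Decides : (ℕ → ℕ) → ℕ → ℕ → Output → Set
  Decides f x t p = A a t (coreView f t x) ≡ just p ×
                    (∀ t′ → t′ < t → A a t′ (coreView f t′ x) ≡ nothing)

  decides-local : ∀ {f g} o c {x t p} → t ≤ x →
    (∀ i → i ≤ x + t → g (o + i) ≡ f (c + i)) →
    Decides f (c + x) t p → Decides g (o + x) t p
  decides-local {f} {g} o c {x} {t} t≤x agree (now , before) =
    trans (cong (A a t) (same t ≤-refl)) now ,
    λ t′ t′<t → trans (cong (A a t′) (same t′ (<⇒≤ t′<t))) (before t′ t′<t)
    where
    same : ∀ t′ → t′ ≤ t → coreView g t′ (o + x) ≡ coreView f t′ (c + x)
    same t′ t′≤t = coreView-local o c t′ x (≤-trans t′≤t t≤x)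
      λ i _ i≤ → agree i (≤-trans i≤ (+-monoʳ-≤ x t′≤t))

  -- Two cores whose outputs under advice a cannot lead to a common node.  The
  -- bounds keep everything inside one period, so that this survives pasting
  -- the period into another word.
  record Conflict (f : ℕ → ℕ) (n : ℕ) : Set where
    field
      x y t u  : ℕ
      p q      : Output
      t≤x      : t ≤ x
      x+t<n    : x + t < n
      u≤y      : u ≤ y
      y+u<n    : y + u < n
      decidesˣ : Decides f x t p
      decidesʸ : Decides f y u q
      p≤x      : length p ≤ x
      x+pq<y   : x + (length p + length q) < y
      y+q<n    : y + length q < n

  -- By the bounds in `Conflict`, both decisions read labels inside `0 .. n - 1` only, so a verbatim
  -- copy of this stretch at offset `o` reproduces them.
  conflict-paste : ∀ {f g n N} o → o + n ≤ N → (∀ i → i < n → g (o + i) ≡ f i) →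
                   Conflict f n → Conflict g N
  conflict-paste {f} {g} {n} {N} o o+n≤N agree C = record
    { x = o + x ; y = o + y ; t = t ; u = u ; p = p ; q = q
    ; t≤x = m≤n⇒m≤o+n o t≤x
    ; x+t<n = inside x+t<n
    ; u≤y = m≤n⇒m≤o+n o u≤y
    ; y+u<n = inside y+u<n
    ; decidesˣ = decides-local o 0 t≤x (λ i i≤ → agree i (≤-<-trans i≤ x+t<n)) decidesˣ
    ; decidesʸ = decides-local o 0 u≤y (λ i i≤ → agree i (≤-<-trans i≤ y+u<n)) decidesʸ
    ; p≤x = m≤n⇒m≤o+n o p≤x
    ; x+pq<y = subst (_< o + y) (sym (+-assoc o x _)) (+-monoʳ-< o x+pq<y)
    ; y+q<n = inside y+q<n
    }
    where
    open Conflict C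
    inside : ∀ {z w} → z + w < n → o + z + w < N
    inside {z} {w} z+w<n =
      <-≤-trans (subst (_< o + n) (sym (+-assoc o z w)) (+-monoʳ-< o z+w<n)) o+n≤N

  module _ (W : Word) where
    open Word W

    private
      just≢nothing : ∀ {p : Output} → just p ≢ nothing
      just≢nothing ()

      just-inj : ∀ {p q : Output} → just p ≡ just q → p ≡ q
      just-inj refl = refl

    -- Views in the ring and on the line agree at all depths up to `x`, and the first round with an
    -- output is unique.
    outputs-decides : ∀ {x t p r o} → t ≤ x → Decides f x t p →
                      OutputsAt graph A a (enc (core x)) r o → o ≡ p
    outputs-decides {x} {t} {p} {r} {o} t≤x (now , before) (now′ , before′) with <-cmp r t
    ... | tri< r<t _ _ = ⊥-elim (just≢nothing (trans (sym now′)
            (trans (cong (A a r) (ℬ-core r x (≤-trans (<⇒≤ r<t) t≤x))) (before r r<t))))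
    ... | tri≈ _ refl _ = just-inj (trans (sym now′) (trans (cong (A a r) (ℬ-core r x t≤x)) now))
    ... | tri> _ _ t<r = ⊥-elim (just≢nothing (trans (sym now)
            (trans (cong (A a t) (sym (ℬ-core t x t≤x))) (before′ t t<r))))

    outputs⇒decides : ∀ {x r o} → r ≤ x → OutputsAt graph A a (enc (core x)) r o → Decides f x r o
    outputs⇒decides {x} {r} r≤x (now , before) =
      trans (cong (A a r) (sym (ℬ-core r x r≤x))) now ,
      λ r′ r′<r → trans (cong (A a r′) (sym (ℬ-core r′ x (≤-trans (<⇒≤ r′<r) r≤x)))) (before r′ r′<r)

    -- A common end `ℓ` would have a coordinate of at most `x + length p` and, seen from the other
    -- core, of at least `y - length q`; the conflict leaves a gap between the two.
    conflict⇒¬elects : ∀ {T} → Conflict f n → ¬ ElectsWithin graph A a T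
    conflict⇒¬elects C (out , outputs , ℓ , paths) = <⇒≱ x+pq<y (begin
      y                                      ≡⟨ coord-y ⟨
      coordinate W Y                         ≤⟨ proj₂ far-y ⟩
      coordinate W ℓ + length q              ≤⟨ +-monoˡ-≤ (length q) (proj₁ far-x) ⟩
      coordinate W X + length p + length q   ≡⟨ cong (λ c → c + length p + length q) coord-x ⟩
      x + length p + length q                ≡⟨ +-assoc x (length p) (length q) ⟩
      x + (length p + length q)              ∎)
      where
      open ≤-Reasoning
      open Conflict C
      X Y : Fin (Graph.n graph)
      X = enc (core x)
      Y = enc (core y)
      coord : ∀ z → z < n → coordinate W (enc (core z)) ≡ z
      coord z z<n = trans (coordinate-enc W (core z)) (trans (toℕ-mod z) (m<n⇒m%n≡m z<n))
      coord-x : coordinate W X ≡ x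
      coord-x = coord x (≤-<-trans (m≤m+n x t) x+t<n)
      coord-y : coordinate W Y ≡ y
      coord-y = coord y (≤-<-trans (m≤m+n y u) y+u<n)
      out-x : out X ≡ p
      out-x = outputs-decides t≤x decidesˣ (proj₂ (proj₂ (outputs X)))
      out-y : out Y ≡ q
      out-y = outputs-decides u≤y decidesʸ (proj₂ (proj₂ (outputs Y)))
      far-x : coordinate W ℓ ≤ coordinate W X + length p × coordinate W X ≤ coordinate W ℓ + length p
      far-x = walk-near W (subst (λ o → Walk graph X o ℓ (proj₁ (paths X))) out-x (proj₁ (proj₂ (paths X))))
        (subst (length p ≤_) (sym coord-x) p≤x)
        (subst (λ c → c + length p < n) (sym coord-x)
          (≤-<-trans (+-monoʳ-≤ x (m≤m+n (length p) (length q)))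
            (<-trans x+pq<y (≤-<-trans (m≤m+n y u) y+u<n))))
      far-y : coordinate W ℓ ≤ coordinate W Y + length q × coordinate W Y ≤ coordinate W ℓ + length q
      far-y = walk-near W (subst (λ o → Walk graph Y o ℓ (proj₁ (paths Y))) out-y (proj₁ (proj₂ (paths Y))))
        (subst (length q ≤_) (sym coord-y)
          (≤-trans (m≤n+m (length q) (length p)) (≤-trans (m≤n+m _ x) (<⇒≤ x+pq<y))))
        (subst (λ c → c + length q < n) (sym coord-y) y+q<n)

-- Windows spliced between unique labels.

splice : ℕ → ℕ → (ℕ → ℕ) → (ℕ → ℕ) → ℕ → ℕ
splice o len g d z with o ≤? z | z <? o + len
... | yes _ | yes _ = g (z ∸ o)
... | _     | _     = d z

splice-inside : ∀ o len g d i → i < len → splice o len g d (o + i) ≡ g i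
splice-inside o len g d i i<len with o ≤? o + i | o + i <? o + len
... | yes _ | yes _ = cong g (m+n∸m≡n o i)
... | yes _ | no ¬p = ⊥-elim (¬p (+-monoʳ-< o i<len))
... | no ¬p | _     = ⊥-elim (¬p (m≤m+n o i))

splice-left : ∀ o len g d z → z < o → splice o len g d z ≡ d z
splice-left o len g d z z<o with o ≤? z | z <? o + len
... | yes o≤z | yes _ = ⊥-elim (<⇒≱ z<o o≤z)
... | yes _   | no _  = refl
... | no _    | _     = refl

splice-right : ∀ o len g d z → o + len ≤ z → splice o len g d z ≡ d z
splice-right o len g d z e≤z with o ≤? z | z <? o + len
... | yes _ | yes z<e = ⊥-elim (<⇒≱ z<e e≤z)
... | yes _ | no _    = refl
... | no _  | _       = refl

splice-cases : ∀ o len g d z → (∃ λ i → i < len × z ≡ o + i) ⊎ splice o len g d z ≡ d z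
splice-cases o len g d z with o ≤? z | z <? o + len
... | no _  | _    = inj₂ refl
... | yes _ | no _ = inj₂ refl
... | yes o≤z | yes z<e with m≤n⇒∃[o]m+o≡n o≤z
... | i , refl = inj₁ (i , +-cancelˡ-< o i len z<e , refl)

-- Close to either end of the window the marker next to it betrays the
-- position; elsewhere two positions are told apart as in the ring of W.
window-injective : (W : Word) → let open Word W in ∀ {s} → Resolves s →
  (label : ℕ → ℕ) (b c : ℕ) →
  (∀ i → i < n + (s + s) → label (s + suc b + i) ≡ f (c + i)) →
  (∀ v → label (s + b) ≡ label v → s + b ≡ v) →
  (∀ v → label (s + suc b + (n + (s + s))) ≡ label v → s + suc b + (n + (s + s)) ≡ v) →
  ∀ i i′ → i < n + (s + s) → i′ < n + (s + s) →
  (∀ j → j ≤ s + s → label (suc b + i + j) ≡ label (suc b + i′ + j)) → i ≡ i′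
window-injective W {s} res label b c inside left right i i′ i< i′< eq =
  cases (position i i<) (position i′ i′<)
  where
  open Word W

  -- At an `atLeft` position the marker before the window is entry `d` of the view; at an `atRight`
  -- position the marker after it is entry `s + suc d`. The `n` middle positions see labels of `W`
  -- only.
  data Position : ℕ → Set where
    atLeft  : ∀ i d → suc (i + d) ≡ s → Position i
    middle  : ∀ k → k < n → Position (s + k)
    atRight : ∀ e d → e + suc d ≡ s → Position (n + s + e)

  position : ∀ i → i < n + (s + s) → Position i
  position i i< with i <? s
  ... | yes i<s = let d , eq = m≤n⇒∃[o]m+o≡n i<s in atLeft i d eq
  ... | no  i≮s with m≤n⇒∃[o]m+o≡n (≮⇒≥ i≮s)
  ... | k , refl with k <? n
  ... | yes k<n = middle k k<n
  ... | no  k≮n with m≤n⇒∃[o]m+o≡n (≮⇒≥ k≮n)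
  ... | e , refl = subst Position (regroup s n e)
      (let d , eq = m≤n⇒∃[o]m+o≡n {suc e} {s} (+-cancelˡ-≤ (n + s) (suc e) s
                      (subst₂ _≤_ (regroup′ s n e) (sym (+-assoc n s s)) i<))
       in atRight e d (trans (+-suc e d) eq))
    where
    regroup : ∀ s n e → n + s + e ≡ s + (n + e)
    regroup = solve-∀
    regroup′ : ∀ s n e → suc (s + (n + e)) ≡ n + s + suc e
    regroup′ = solve-∀

  fromLeft : ∀ i i′ d → suc (i + d) ≡ s →
    (∀ j → j ≤ s + s → label (suc b + i + j) ≡ label (suc b + i′ + j)) → i ≡ i′
  fromLeft i i′ d refl eq = +-cancelʳ-≡ d i i′ (+-cancelˡ-≡ (suc b) _ _
    (trans (regroup₂ b i d)
      (trans (left _ (trans (cong label (regroup b i d)) (eq d d≤))) (+-assoc (suc b) i′ d))))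
    where
    d≤ : d ≤ suc (i + d) + suc (i + d)
    d≤ = ≤-trans (m≤n+m d (suc i)) (m≤m+n _ _)
    regroup : ∀ b i d → suc (i + d) + b ≡ suc b + i + d
    regroup = solve-∀
    regroup₂ : ∀ b i d → suc b + (i + d) ≡ suc (i + d) + b
    regroup₂ = solve-∀

  fromRight : ∀ e i′ d → e + suc d ≡ s →
    (∀ j → j ≤ s + s → label (suc b + (n + s + e) + j) ≡ label (suc b + i′ + j)) → n + s + e ≡ i′
  fromRight e i′ d es eq = +-cancelˡ-≡ (suc b) _ _ (+-cancelʳ-≡ (s + suc d) _ _
    (trans (sym place) (right _ (trans (cong label place) (eq (s + suc d) (+-monoʳ-≤ s d≤))))))
    where
    d≤ : suc d ≤ s
    d≤ = ≤-trans (m≤n+m (suc d) e) (≤-reflexive es)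
    regroup : ∀ n b s e d → s + suc b + (n + (s + (e + suc d))) ≡ suc b + (n + s + e) + (s + suc d)
    regroup = solve-∀
    place : s + suc b + (n + (s + s)) ≡ suc b + (n + s + e) + (s + suc d)
    place = trans (cong (λ a → s + suc b + (n + (s + a))) (sym es)) (regroup n b s e d)

  cases : Position i → Position i′ → i ≡ i′
  cases (atLeft _ d es)   _                 = fromLeft i i′ d es eq
  cases _                 (atLeft _ d es)   = sym (fromLeft i′ i d es (λ j j≤ → sym (eq j j≤)))
  cases (atRight e d es)  _                 = fromRight e i′ d es eq
  cases _                 (atRight e d es)  = sym (fromRight e i d es (λ j j≤ → sym (eq j j≤)))
  cases (middle k k<n)    (middle k′ k′<n)  = cong (s +_)
    (trans (sym (m<n⇒m%n≡m k<n)) (trans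
      (%-+-cancelʳ n k k′ c (res (k + c) (k′ + c) λ j j≤ →
        trans (sym (value k k<n j j≤)) (trans (eq j j≤) (value k′ k′<n j j≤))))
      (m<n⇒m%n≡m k′<n)))
    where
    regroup : ∀ s b k j → suc b + (s + k) + j ≡ s + suc b + (k + j)
    regroup = solve-∀
    regroup′ : ∀ c k j → c + (k + j) ≡ k + c + j
    regroup′ = solve-∀
    value : ∀ k → k < n → ∀ j → j ≤ s + s → label (suc b + (s + k) + j) ≡ f (k + c + j)
    value k k<n j j≤ = trans (cong label (regroup s b k j))
      (trans (inside (k + j) (+-mono-<-≤ k<n j≤)) (cong f (regroup′ c k j)))

-- Pasting two words into a bigger one.

-- Windows of the two words, each one period extended by s on both sides, are
-- separated by blocks of length s + suc k of unique labels F + position.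
module Merge (W₁ W₂ : Word) (s k F : ℕ)
  (f₁<f₂ : ∀ x y → Word.f W₁ x < Word.f W₂ y)
  (f₂<F : ∀ y → Word.f W₂ y < F) where

  open Word W₁ using () renaming (h to h₁; m to m₁; n to n₁; f to f₁; Resolves to Resolves₁)
  open Word W₂ using () renaming (h to h₂; m to m₂; n to n₂; f to f₂; Resolves to Resolves₂)

  -- Windows occupy `o .. e - 1`. The phase `c = s * m` makes index `s` of a window the start of a
  -- period, as `c + s` is a multiple of the old period. The last block of markers has length
  -- `o₁ + suc o₁`, which makes the new period `N` odd.
  len₁ len₂ b₂ o₁ o₂ e₁ e₂ c₁ c₂ H N : ℕ
  len₁ = n₁ + (s + s)
  len₂ = n₂ + (s + s)
  o₁ = s + suc k
  e₁ = o₁ + len₁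
  b₂ = e₁ + k
  o₂ = s + suc b₂
  e₂ = o₂ + len₂
  c₁ = s * m₁
  c₂ = s * m₂
  H = suc (h₁ + h₂ + (s + s) + (o₁ + o₁))
  N = suc (H + H)

  N≡ : N ≡ e₂ + (o₁ + suc o₁)
  N≡ = regroup h₁ h₂ s k
    where
    regroup : ∀ h₁ h₂ s k → let o₁ = s + suc k ; H = suc (h₁ + h₂ + (s + s) + (o₁ + o₁)) in
      suc (H + H) ≡
        s + suc (o₁ + (suc (h₁ + h₁) + (s + s)) + k) + (suc (h₂ + h₂) + (s + s)) + (o₁ + suc o₁)
    regroup = solve-∀

  e₁≤o₂ : e₁ ≤ o₂
  e₁≤o₂ = ≤-trans (m≤m+n e₁ k) (≤-trans (n≤1+n _) (m≤n+m _ s))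

  e₂≤N : e₂ ≤ N
  e₂≤N = ≤-trans (m≤m+n e₂ _) (≤-reflexive (sym N≡))

  e₁≤N : e₁ ≤ N
  e₁≤N = ≤-trans e₁≤o₂ (≤-trans (m≤m+n o₂ len₂) e₂≤N)

  label : ℕ → ℕ
  label = splice o₁ len₁ (λ i → f₁ (c₁ + i)) (splice o₂ len₂ (λ i → f₂ (c₂ + i)) (F +_))

  label-window₁ : ∀ i → i < len₁ → label (o₁ + i) ≡ f₁ (c₁ + i)
  label-window₁ i i< = splice-inside o₁ len₁ _ _ i i<

  label-window₂ : ∀ i → i < len₂ → label (o₂ + i) ≡ f₂ (c₂ + i)
  label-window₂ i i< = trans
    (splice-right o₁ len₁ _ _ (o₂ + i) (≤-trans e₁≤o₂ (m≤m+n o₂ i)))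
    (splice-inside o₂ len₂ _ _ i i<)

  data Zone (z : ℕ) : Set where
    window₁ : ∀ i → i < len₁ → z ≡ o₁ + i → Zone z
    window₂ : ∀ i → i < len₂ → z ≡ o₂ + i → Zone z
    marker  : label z ≡ F + z → Zone z

  zone : ∀ z → Zone z
  zone z with splice-cases o₁ len₁ (λ i → f₁ (c₁ + i)) (splice o₂ len₂ (λ i → f₂ (c₂ + i)) (F +_)) z
  ... | inj₁ (i , i< , eq) = window₁ i i< eq
  ... | inj₂ out₁ with splice-cases o₂ len₂ (λ i → f₂ (c₂ + i)) (F +_) z
  ... | inj₁ (i , i< , eq) = window₂ i i< eq
  ... | inj₂ out₂ = marker (trans out₁ out₂)

  f₁<F : ∀ x → f₁ x < F
  f₁<F x = <-trans (f₁<f₂ x 0) (f₂<F 0)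

  label< : ∀ B → F + N ≤ B → ∀ z → z < N → label z < B
  label< B F+N≤B z z<N with zone z
  ... | window₁ i i< refl = subst (_< B) (sym (label-window₁ i i<))
          (<-≤-trans (f₁<F _) (≤-trans (m≤m+n F N) F+N≤B))
  ... | window₂ i i< refl = subst (_< B) (sym (label-window₂ i i<))
          (<-≤-trans (f₂<F _) (≤-trans (m≤m+n F N) F+N≤B))
  ... | marker eq = subst (_< B) (sym eq) (<-≤-trans (+-monoʳ-< F z<N) F+N≤B)

  label≥ : ∀ B → (∀ x → B ≤ f₁ x) → ∀ z → B ≤ label z
  label≥ B B≤f₁ z with zone z
  ... | window₁ i i< refl = subst (B ≤_) (sym (label-window₁ i i<)) (B≤f₁ _)
  ... | window₂ i i< refl = subst (B ≤_) (sym (label-window₂ i i<))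
          (≤-trans (B≤f₁ 0) (<⇒≤ (f₁<f₂ 0 _)))
  ... | marker eq = subst (B ≤_) (sym eq)
          (≤-trans (B≤f₁ 0) (≤-trans (<⇒≤ (f₁<F 0)) (m≤m+n F z)))

  -- Markers are at least `F`, above all labels of both words, and differ among themselves because
  -- they encode their positions.
  marker-unique : ∀ u v → label u ≡ F + u → label u ≡ label v → u ≡ v
  marker-unique u v mu eq with zone v
  ... | window₁ i i< refl = ⊥-elim (<⇒≱ (f₁<F (c₁ + i))
          (≤-trans (m≤m+n F u) (≤-reflexive (trans (sym mu) (trans eq (label-window₁ i i<))))))
  ... | window₂ i i< refl = ⊥-elim (<⇒≱ (f₂<F (c₂ + i))
          (≤-trans (m≤m+n F u) (≤-reflexive (trans (sym mu) (trans eq (label-window₂ i i<))))))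
  ... | marker mv = +-cancelˡ-≡ F u v (trans (sym mu) (trans eq mv))

  marker-before₁ : ∀ z → z < o₁ → label z ≡ F + z
  marker-before₁ z z<o₁ = trans (splice-left o₁ len₁ _ _ z z<o₁)
    (splice-left o₂ len₂ _ _ z (<-≤-trans z<o₁ (≤-trans (m≤m+n o₁ len₁) e₁≤o₂)))

  marker-between : ∀ z → e₁ ≤ z → z < o₂ → label z ≡ F + z
  marker-between z e₁≤z z<o₂ = trans (splice-right o₁ len₁ _ _ z e₁≤z) (splice-left o₂ len₂ _ _ z z<o₂)

  marker-after₂ : ∀ z → e₂ ≤ z → label z ≡ F + z
  marker-after₂ z e₂≤z =
    trans (splice-right o₁ len₁ _ _ z (≤-trans e₁≤o₂ (≤-trans (m≤m+n o₂ len₂) e₂≤z)))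
          (splice-right o₂ len₂ _ _ z e₂≤z)

  word : Word
  word = record
    { h = H ; f = λ x → label (x % N) ; 1≤h = s≤s z≤n
    ; periodic = λ x → cong label (m%n%n≡m%n x N) }

  open Word word using () renaming (f to g; Resolves to Resolvesᴺ)

  g-label : ∀ z → z < N → g z ≡ label z
  g-label z z<N = cong label (m<n⇒m%n≡m z<N)

  g-window₁ : ∀ i → i < len₁ → g (o₁ + i) ≡ f₁ (c₁ + i)
  g-window₁ i i< = trans (g-label _ (<-≤-trans (+-monoʳ-< o₁ i<) e₁≤N)) (label-window₁ i i<)

  g-window₂ : ∀ i → i < len₂ → g (o₂ + i) ≡ f₂ (c₂ + i)
  g-window₂ i i< = trans (g-label _ (<-≤-trans (+-monoʳ-< o₂ i<) e₂≤N)) (label-window₂ i i<)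

  private
    unwrap : ∀ b x i → (x + s) % N ≡ s + suc b + i → ∀ j → suc b + i + j < N →
             g (x + j) ≡ label (suc b + i + j)
    unwrap b x i eq j j<N = cong label (trans
      (%-+-congʳ N x (suc b + i) j (%-+-cancelʳ N x (suc b + i) s (begin
        (x + s) % N           ≡⟨ m%n%n≡m%n (x + s) N ⟨
        (x + s) % N % N       ≡⟨ cong (_% N) (trans eq (regroup s b i)) ⟩
        (suc b + i + s) % N   ∎)))
      (m<n⇒m%n≡m j<N))
      where
      open ≡-Reasoning
      regroup : ∀ s b i → s + suc b + i ≡ suc b + i + s
      regroup = solve-∀

    -- Looking `s` positions past the end of a window does not leave the period, because the final
    -- block of markers is longer than `s`.
    fits : ∀ b len → s + suc b + len ≤ e₂ → ∀ i j → i < len → j ≤ s + s → suc b + i + j < N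
    fits b len le i j i<len j≤ = begin-strict
      suc b + i + j               ≤⟨ +-monoʳ-≤ (suc b + i) j≤ ⟩
      suc b + i + (s + s)         ≡⟨ regroup s b i ⟩
      s + suc b + i + s           <⟨ +-monoˡ-< s (+-monoʳ-< (s + suc b) i<len) ⟩
      s + suc b + len + s         ≤⟨ +-mono-≤ le (≤-trans (m≤m+n s (suc k)) (m≤m+n o₁ (suc o₁))) ⟩
      e₂ + (o₁ + suc o₁)          ≡⟨ N≡ ⟨
      N                           ∎
      where
      open ≤-Reasoning
      regroup : ∀ s b i → suc b + i + (s + s) ≡ s + suc b + i + s
      regroup = solve-∀

  -- The label at the centre reveals the zone: a marker is unique, and the two words use disjoint
  -- labels. Within one window, `window-injective` decides.
  word-resolves : Resolves₁ s → Resolves₂ s → Resolvesᴺ s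
  word-resolves res₁ res₂ x y eq = %-+-cancelʳ N x y s (same (zone z) (zone z′))
    where
    z z′ : ℕ
    z  = (x + s) % N
    z′ = (y + s) % N
    eqˢ : label z ≡ label z′
    eqˢ = eq s (m≤m+n s s)
    same : Zone z → Zone z′ → z ≡ z′
    same (marker mz) _ = marker-unique z z′ mz eqˢ
    same _ (marker mz′) = sym (marker-unique z′ z mz′ (sym eqˢ))
    same (window₁ i i< zi) (window₂ i′ i′< zi′) = ⊥-elim (<⇒≢ (f₁<f₂ (c₁ + i) (c₂ + i′))
      (trans (sym (trans (cong label zi) (label-window₁ i i<)))
             (trans eqˢ (trans (cong label zi′) (label-window₂ i′ i′<)))))
    same (window₂ i i< zi) (window₁ i′ i′< zi′) = ⊥-elim (<⇒≢ (f₁<f₂ (c₁ + i′) (c₂ + i))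
      (trans (sym (trans (cong label zi′) (label-window₁ i′ i′<)))
             (trans (sym eqˢ) (trans (cong label zi) (label-window₂ i i<)))))
    same (window₁ i i< zi) (window₁ i′ i′< zi′) = trans zi (trans (cong (o₁ +_)
      (window-injective W₁ res₁ label k c₁ label-window₁
        (λ v → marker-unique (s + k) v (marker-before₁ (s + k) (+-monoʳ-< s (n<1+n k))))
        (λ v → marker-unique e₁ v (marker-between e₁ ≤-refl
          (≤-trans (s≤s (m≤m+n e₁ k)) (m≤n+m _ s))))
        i i′ i< i′< λ j j≤ → trans (sym (unwrap k x i zi j (fits k len₁ le i j i< j≤)))
          (trans (eq j j≤) (unwrap k y i′ zi′ j (fits k len₁ le i′ j i′< j≤)))))
      (sym zi′))
      where
      le : e₁ ≤ e₂
      le = ≤-trans e₁≤o₂ (m≤m+n o₂ len₂)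
    same (window₂ i i< zi) (window₂ i′ i′< zi′) = trans zi (trans (cong (o₂ +_)
      (window-injective W₂ res₂ label b₂ c₂ label-window₂
        (λ v → marker-unique (s + b₂) v (marker-between (s + b₂)
          (≤-trans (m≤m+n e₁ k) (m≤n+m b₂ s)) (+-monoʳ-< s (n<1+n b₂))))
        (λ v → marker-unique e₂ v (marker-after₂ e₂ ≤-refl))
        i i′ i< i′< λ j j≤ → trans (sym (unwrap b₂ x i zi j (fits b₂ len₂ ≤-refl i j i< j≤)))
          (trans (eq j j≤) (unwrap b₂ y i′ zi′ j (fits b₂ len₂ ≤-refl i′ j i′< j≤)))))
      (sym zi′))

  module _ (A : DistAlg) where

    -- From `o₁ + s` on, the first window spells out a full period of `f₁` starting at position 0,
    -- since `c₁ + s` is a multiple of `n₁`.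
    conflict-inherited : ∀ a → Conflict A a f₁ n₁ → Conflict A a g N
    conflict-inherited a = conflict-paste A a (o₁ + s)
      (≤-trans (subst (_≤ e₁) (sym (+-assoc o₁ s n₁)) (+-monoʳ-≤ o₁ s+n₁≤len₁)) e₁≤N)
      λ i i<n₁ → trans (cong g (+-assoc o₁ s i)) (trans
        (g-window₁ (s + i) (<-≤-trans (+-monoʳ-< s i<n₁) s+n₁≤len₁))
        (f-cong (c₁ + (s + i)) i (trans (cong (_% n₁) (unshift s m₁ i)) ([m+kn]%n≡m%n i s n₁))))
      where
      open Word W₁ using (f-cong)
      regroup : ∀ s n → s + (s + n) ≡ n + (s + s)
      regroup = solve-∀
      s+n₁≤len₁ : s + n₁ ≤ len₁
      s+n₁≤len₁ = ≤-trans (m≤n+m (s + n₁) s) (≤-reflexive (regroup s n₁))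
      unshift : ∀ s m i → s * m + (s + i) ≡ i + s * suc m
      unshift = solve-∀

    -- The cores opposite to the seams of the two windows.
    conflict-created : ∀ a {t u p q} → t ≤ s + h₁ → u ≤ s + h₂ → length p + length q ≤ k →
      Decides A a f₁ (c₁ + (s + h₁)) t p → Decides A a f₂ (c₂ + (s + h₂)) u q →
      Conflict A a g N
    conflict-created a {t} {u} {p} {q} t≤ u≤ pq≤k dec₁ dec₂ = record
      { x = o₁ + (s + h₁) ; y = o₂ + (s + h₂) ; t = t ; u = u ; p = p ; q = q
      ; t≤x = m≤n⇒m≤o+n o₁ t≤
      ; x+t<n = <-≤-trans (reach o₁ t h₁ t≤) e₁≤N
      ; u≤y = m≤n⇒m≤o+n o₂ u≤
      ; y+u<n = <-≤-trans (reach o₂ u h₂ u≤) e₂≤N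
      ; decidesˣ = decides-local A a o₁ c₁ t≤
          (λ i i≤ → g-window₁ i (≤-<-trans i≤ (short t h₁ t≤))) dec₁
      ; decidesʸ = decides-local A a o₂ c₂ u≤
          (λ i i≤ → g-window₂ i (≤-<-trans i≤ (short u h₂ u≤))) dec₂
      ; p≤x = begin
          length p              ≤⟨ m≤m+n (length p) (length q) ⟩
          length p + length q   ≤⟨ pq≤k ⟩
          k                     ≤⟨ ≤-trans (n≤1+n k) (m≤n+m (suc k) s) ⟩
          o₁                    ≤⟨ m≤m+n o₁ _ ⟩
          o₁ + (s + h₁)         ∎
      ; x+pq<y = begin-strict
          -- The markers between the windows outnumber `k`, so two paths of total length at most `k`
          -- cannot bridge them.
          o₁ + (s + h₁) + (length p + length q)
                                ≤⟨ +-mono-≤ (<⇒≤ (≤-<-trans (m≤m+n _ t) (reach o₁ t h₁ t≤))) pq≤k ⟩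
          e₁ + k                <⟨ n<1+n b₂ ⟩
          suc b₂                ≤⟨ m≤n+m (suc b₂) s ⟩
          o₂                    ≤⟨ m≤m+n o₂ _ ⟩
          o₂ + (s + h₂)         ∎
      ; y+q<n = begin-strict
          o₂ + (s + h₂) + length q  <⟨ +-mono-<-≤ (≤-<-trans (m≤m+n _ u) (reach o₂ u h₂ u≤))
                                        (≤-trans (m≤n+m (length q) (length p)) pq≤k) ⟩
          e₂ + k                ≤⟨ +-monoʳ-≤ e₂ (≤-trans (≤-trans (n≤1+n k) (m≤n+m (suc k) s))
                                                   (m≤m+n o₁ (suc o₁))) ⟩
          e₂ + (o₁ + suc o₁)    ≡⟨ N≡ ⟨
          N                     ∎
      }
      where
      open ≤-Reasoning
      -- A window has length `2 (s + h) + 1` and `s + h` is its exact middle, so `s + h` rounds do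
      -- not see beyond either end.
      short : ∀ t h → t ≤ s + h → s + h + t < suc (h + h) + (s + s)
      short t h t≤ = s≤s (≤-trans (+-monoʳ-≤ (s + h) t≤) (≤-reflexive (regroup s h)))
        where
        regroup : ∀ s h → s + h + (s + h) ≡ h + h + (s + s)
        regroup = solve-∀
      reach : ∀ o t h → t ≤ s + h → o + (s + h) + t < o + (suc (h + h) + (s + s))
      reach o t h t≤ = subst (_< o + (suc (h + h) + (s + s))) (sym (+-assoc o (s + h) t))
        (+-monoʳ-< o (short t h t≤))

-- Counting short advice strings.

strings : ℕ → List (List Bool)
strings zero    = []
strings (suc L) = [] ∷ map (true ∷_) (strings L) ++ map (false ∷_) (strings L)

-- There are `2 ^ L - 1` strings of length less than `L`, so `2 ^ L` choices among them must repeat.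
length-strings : ∀ L → suc (length (strings L)) ≡ 2 ^ L
length-strings zero    = refl
length-strings (suc L) = begin
  2 + length (map (true ∷_) (strings L) ++ map (false ∷_) (strings L))
    ≡⟨ cong (2 +_) (trans (length-++ (map (true ∷_) (strings L)))
         (cong₂ _+_ (length-map (true ∷_) (strings L)) (length-map (false ∷_) (strings L)))) ⟩
  2 + (ℓ + ℓ)      ≡⟨ regroup ℓ ⟩
  2 * suc ℓ        ≡⟨ cong (2 *_) (length-strings L) ⟩
  2 * 2 ^ L        ∎
  where
  open ≡-Reasoning
  ℓ : ℕ
  ℓ = length (strings L)
  regroup : ∀ l → 2 + (l + l) ≡ 2 * suc l
  regroup = solve-∀

∈-strings : ∀ L a → length a < L → a ∈ strings L
∈-strings (suc L) []          _         = here refl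
∈-strings (suc L) (true  ∷ a) (s≤s a<L) = there (∈-++⁺ˡ (∈-map⁺ (true ∷_) (∈-strings L a a<L)))
∈-strings (suc L) (false ∷ a) (s≤s a<L) =
  there (∈-++⁺ʳ (map (true ∷_) (strings L)) (∈-map⁺ (false ∷_) (∈-strings L a a<L)))

strings-pigeonhole : ∀ L (g : Fin (2 ^ L) → List Bool) → (∀ i → length (g i) < L) →
                     ∃₂ λ i j → i Fin.< j × g i ≡ g j
strings-pigeonhole L g short
  with Fin.pigeonhole (≤-reflexive (length-strings L)) (λ i → index (∈-strings L (g i) (short i)))
... | i , j , i<j , eq = i , j , i<j , trans (lookup-index (∈-strings L (g i) (short i)))
  (trans (cong (lookup (strings L)) eq) (sym (lookup-index (∈-strings L (g j) (short j)))))

-- The induction on excluded advice strings.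

base : ℕ → Word
base F = record
  { h = 1 ; f = λ x → F + x % 3 ; 1≤h = ≤-refl
  ; periodic = λ x → cong (F +_) (m%n%n≡m%n x 3) }

-- The three cores carry distinct labels, so a single label gives the position.
base-resolves : ∀ F → Word.Resolves (base F) 0
base-resolves F x y eq = subst₂ (λ a b → a % 3 ≡ b % 3) (+-identityʳ x) (+-identityʳ y)
  (+-cancelˡ-≡ F _ _ (eq 0 z≤n))

-- A word that resolves at `ρ` has election index at most `ρ + 1` and diameter at most `h + 2`, so
-- its nodes stop within `h + (2 + τ (suc ρ))` rounds. The summand besides `h` is the margin used in
-- the next pasting, and the pasted word resolves at that radius.
radius : (ℕ → ℕ) → ℕ → ℕ
radius τ zero    = 0
radius τ (suc i) = 2 + τ (suc (radius τ i))

module _ (τ : ℕ → ℕ) (τ-mono : ∀ {x y} → x ≤ y → τ x ≤ τ y) (τ-inflationary : ∀ x → x ≤ τ x)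
         (O : Oracle) (A : DistAlg) (works : WorksInTime (λ D φ → D + τ φ) O A) where

  radius-suc : ∀ i → radius τ i ≤ radius τ (suc i)
  radius-suc i = ≤-trans (≤-trans (n≤1+n _) (τ-inflationary _)) (m≤n⇒m≤o+n 2 ≤-refl)

  module _ (W : Word) where
    open Word W

    elects : ∀ r → Resolves r →
             ∃ λ T → T ≤ (2 + τ (suc r)) + h × ElectsWithin graph A (O graph) T
    elects r res = D + τ φ , bound ,
      works graph isGraph (distinctB⇒feasible graph (suc r) (resolves⇒distinctB {r} res)) D φ isD isφ
      where
      diam : ∃ λ D → D ≤ suc (h + 1) × IsDiameter graph D
      diam = diameter graph _ graph-within
      index′ : ∃ λ φ → φ ≤ suc r × IsElectionIndex graph φ
      index′ = electionIndex graph (suc r) (resolves⇒distinctB {r} res)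
      D φ : ℕ
      D = proj₁ diam
      φ = proj₁ index′
      isD : IsDiameter graph D
      isD = proj₂ (proj₂ diam)
      isφ : IsElectionIndex graph φ
      isφ = proj₂ (proj₂ index′)
      regroup : ∀ h t → suc (h + 1) + t ≡ 2 + t + h
      regroup = solve-∀
      bound : D + τ φ ≤ 2 + τ (suc r) + h
      bound = ≤-trans (+-mono-≤ (proj₁ (proj₂ diam)) (τ-mono (proj₁ (proj₂ index′))))
                      (≤-reflexive (regroup h _))

    -- The position is at least the running time `s + h`, so the execution in the ring is the one on
    -- the line.
    decision : ∀ r → Resolves r → ∀ c → let s = 2 + τ (suc r) in
               ∃₂ λ t p → t ≤ s + h × Decides A (O graph) f (c + (s + h)) t p
    decision r res c with elects r res
    ... | T , T≤ , out , outputs , _ with outputs (enc (core (c + (2 + τ (suc r) + h))))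
    ... | t , t≤T , o = t , _ , ≤-trans t≤T T≤ ,
      outputs⇒decides A (O graph) W (≤-trans (≤-trans t≤T T≤) (m≤n+m _ c)) o

  module _ (L : ℕ) where

    LongAdvice : ℕ → Set
    LongAdvice ρ = ∃ λ G → IsGraph G × Feasible G ×
      (∃ λ φ → IsElectionIndex G φ × φ ≤ ρ) × L ≤ length (O G)

    longAdvice-mono : ∀ {ρ σ} → ρ ≤ σ → LongAdvice ρ → LongAdvice σ
    longAdvice-mono ρ≤σ (G , isG , feas , (φ , isφ , φ≤ρ) , long) =
      G , isG , feas , (φ , isφ , ≤-trans φ≤ρ ρ≤σ) , long

    -- The state after `i` pastings: `i` distinct short strings with which the ring of `word` cannot
    -- elect a leader. The range from `lo` to `hi` is there to choose words with disjoint labels.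
    record Level (i : ℕ) : Set where
      field
        word      : Word
      open Word word public
      field
        resolves  : Resolves (radius τ i)
        lo hi     : ℕ
        lo≤       : ∀ x → lo ≤ f x
        <hi       : ∀ x → f x < hi
        advice    : Fin i → List Bool
        short     : ∀ a → length (advice a) < L
        different : ∀ a b → a Fin.< b → advice a ≢ advice b
        conflict  : ∀ a → Conflict A (advice a) f n

    open Level using (lo; hi; graph)

    longAdvice : ∀ {i} (ℓ : Level i) → L ≤ length (O (graph ℓ)) → LongAdvice (suc (radius τ i))
    longAdvice {i} ℓ long =
      let φ , φ≤ , isφ = electionIndex graph′ (suc (radius τ i)) dist in
      graph′ , isGraph , distinctB⇒feasible graph′ _ dist , (φ , isφ , φ≤) , long
      where
      open Level ℓ using (isGraph; resolves; resolves⇒distinctB) renaming (graph to graph′)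
      dist : DistinctB graph′ (suc (radius τ i))
      dist = resolves⇒distinctB {radius τ i} resolves

    -- The common advice becomes a conflict of the pasted word, and the conflicts of `ℓ₁` survive.
    -- The new string is not an old one (`fresh`), because the algorithm does elect in the ring of
    -- `ℓ₁` with it. Keeping `lo` lets the result lie above any prescribed bound.
    merge : ∀ {i} (ℓ₁ ℓ₂ : Level i) → hi ℓ₁ ≤ lo ℓ₂ → O (graph ℓ₁) ≡ O (graph ℓ₂) →
            length (O (graph ℓ₁)) < L → Σ (Level (suc i)) λ ℓ → lo ℓ ≡ lo ℓ₁
    merge {i} ℓ₁ ℓ₂ hi≤lo same len<L = record
      { word      = M.word
      ; resolves  = M.word-resolves (ℓ₁.resolves-mono (radius-suc i) ℓ₁.resolves)
                                    (ℓ₂.resolves-mono (radius-suc i) ℓ₂.resolves)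
      ; lo        = ℓ₁.lo
      ; hi        = ℓ₂.hi + M.N
      ; lo≤       = λ x → M.label≥ ℓ₁.lo ℓ₁.lo≤ (x % M.N)
      ; <hi       = λ x → M.label< (ℓ₂.hi + M.N) ≤-refl (x % M.N) (m%n<n x M.N)
      ; advice    = advice
      ; short     = λ { zero → len<L ; (suc a) → ℓ₁.short a }
      ; different = λ { zero (suc b) _ → fresh b
                      ; (suc a) (suc b) (s≤s a<b) → ℓ₁.different a b a<b }
      ; conflict  = λ { zero → created ; (suc a) → M.conflict-inherited A _ (ℓ₁.conflict a) }
      } , refl
      where
      module ℓ₁ = Level ℓ₁
      module ℓ₂ = Level ℓ₂
      s : ℕ
      s = radius τ (suc i)
      out₁ = decision ℓ₁.word (radius τ i) ℓ₁.resolves (s * ℓ₁.m)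
      out₂ = decision ℓ₂.word (radius τ i) ℓ₂.resolves (s * ℓ₂.m)
      p q : Output
      p = proj₁ (proj₂ out₁)
      q = proj₁ (proj₂ out₂)
      -- The separating blocks are sized by the total length of the two outputs; the markers start
      -- at `ℓ₂.hi`, above all labels in use.
      module M = Merge ℓ₁.word ℓ₂.word s (length p + length q) ℓ₂.hi
        (λ x y → <-≤-trans (ℓ₁.<hi x) (≤-trans hi≤lo (ℓ₂.lo≤ y))) ℓ₂.<hi
      advice : Fin (suc i) → List Bool
      advice zero    = O (graph ℓ₁)
      advice (suc a) = ℓ₁.advice a
      fresh : ∀ b → O (graph ℓ₁) ≢ ℓ₁.advice b
      fresh b eq = conflict⇒¬elects A (O (graph ℓ₁)) ℓ₁.word
        (subst (λ a → Conflict A a ℓ₁.f ℓ₁.n) (sym eq) (ℓ₁.conflict b))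
        (proj₂ (proj₂ (elects ℓ₁.word (radius τ i) ℓ₁.resolves)))
      created : Conflict A (O (graph ℓ₁)) (Word.f M.word) M.N
      created = M.conflict-created A (O (graph ℓ₁))
        (proj₁ (proj₂ (proj₂ out₁))) (proj₁ (proj₂ (proj₂ out₂))) ≤-refl
        (proj₂ (proj₂ (proj₂ out₁)))
        -- The second decision was made under the advice for `ℓ₂`, which is the same string.
        (subst (λ a → Decides A a ℓ₂.f (s * ℓ₂.m + (s + ℓ₂.h)) (proj₁ out₂) q) (sym same)
          (proj₂ (proj₂ (proj₂ out₂))))

    record Family (i K F : ℕ) : Set where
      field
        member  : Fin K → Level i
        above   : ∀ a → F ≤ lo (member a)
        ordered : ∀ a b → a Fin.< b → hi (member a) ≤ lo (member b)

    -- The arbitrary lower bound `F` on labels is what makes it possible to draw many levels with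
    -- disjoint labels.
    Supply : ℕ → Set
    Supply i = ∀ F → LongAdvice (suc (radius τ i)) ⊎ Σ (Level i) λ ℓ → F ≤ lo ℓ

    family : ∀ {i} → Supply i → ∀ K F → LongAdvice (suc (radius τ i)) ⊎ Family i K F
    family supply zero    F = inj₂ record { member = λ () ; above = λ () ; ordered = λ () }
    family supply (suc K) F with supply F
    ... | inj₁ found = inj₁ found
    ... | inj₂ (ℓ , F≤) with family supply K (hi ℓ)
    ... | inj₁ found = inj₁ found
    ... | inj₂ Φ = inj₂ record
      { member  = λ { zero → ℓ ; (suc a) → member a }
      ; above   = λ { zero → F≤
                    ; (suc a) → ≤-trans F≤ (≤-trans lo≤hi (above a)) }
      ; ordered = λ { zero (suc b) _ → above b ; (suc a) (suc b) (s≤s a<b) → ordered a b a<b }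
      }
      where
      open Family Φ
      lo≤hi : lo ℓ ≤ hi ℓ
      lo≤hi = ≤-trans (Level.lo≤ ℓ 0) (<⇒≤ (Level.<hi ℓ 0))

    -- Among `2 ^ L` levels with disjoint labels, either one receives long advice or two receive the
    -- same short string and can be merged.
    supply : ∀ i → Supply i
    supply zero F = inj₂ (record
      { word = base F ; resolves = base-resolves F ; lo = F ; hi = F + 3
      ; lo≤ = λ x → m≤m+n F _ ; <hi = λ x → +-monoʳ-< F (m%n<n x 3)
      ; advice = λ () ; short = λ () ; different = λ () ; conflict = λ () } , ≤-refl)
    supply (suc i) F with family (supply i) (2 ^ L) F
    ... | inj₁ found = inj₁ (longAdvice-mono (s≤s (radius-suc i)) found)
    ... | inj₂ Φ with Fin.any? (λ a → L ≤? length (O (graph (Family.member Φ a))))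
    ... | yes (a , long) =
          inj₁ (longAdvice-mono (s≤s (radius-suc i)) (longAdvice (Family.member Φ a) long))
    ... | no ¬long with strings-pigeonhole L (λ a → O (graph (Family.member Φ a)))
                                             (λ a → ≰⇒> (¬long ∘ (a ,_)))
    ... | a , b , a<b , same =
          let ℓ , lo≡ = merge (member a) (member b) (ordered a b a<b) same (≰⇒> (¬long ∘ (a ,_))) in
          inj₂ (ℓ , ≤-trans (above a) (≤-reflexive (sym lo≡)))
      where open Family Φ

    -- A level `2 ^ L` would exclude `2 ^ L` distinct strings shorter than `L`, more than there are,
    -- so the search must have ended with long advice.
    longAdvice-exists : LongAdvice (suc (radius τ (2 ^ L)))
    longAdvice-exists with supply (2 ^ L) 0
    ... | inj₁ found = found
    ... | inj₂ (ℓ , _) = let a , b , a<b , same = strings-pigeonhole L advice short in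
                         ⊥-elim (different a b a<b same)
      where open Level ℓ

-- Logarithms and the passage from `L` to `α`.

n<2^n : ∀ n → n < 2 ^ n
n<2^n zero    = ≤-refl
n<2^n (suc n) = ≤-trans (+-mono-≤ (m^n>0 2 n) (n<2^n n))
                        (≤-reflexive (cong (2 ^ n +_) (sym (+-identityʳ (2 ^ n)))))

-- The value `k` of the logarithm is a separate argument so that the recursion is structural in it
-- while `n` is halved.
2^⌊log₂n⌋≤n : ∀ k n → 1 ≤ n → ⌊log₂ n ⌋ ≡ k → 2 ^ k ≤ n
2^⌊log₂n⌋≤n zero    n             1≤n _  = 1≤n
2^⌊log₂n⌋≤n (suc k) (suc zero)    _   ()
2^⌊log₂n⌋≤n (suc k) n@(suc (suc x)) _ eq = begin
  2 * 2 ^ k                  ≤⟨ *-monoʳ-≤ 2 (2^⌊log₂n⌋≤n k ⌊ n /2⌋ (s≤s z≤n)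
                                  (trans (⌊log₂⌊n/2⌋⌋≡⌊log₂n⌋∸1 n) (cong pred eq))) ⟩
  2 * ⌊ n /2⌋                ≡⟨ cong (⌊ n /2⌋ +_) (+-identityʳ _) ⟩
  ⌊ n /2⌋ + ⌊ n /2⌋          ≤⟨ +-monoʳ-≤ ⌊ n /2⌋ (⌊n/2⌋≤⌈n/2⌉ n) ⟩
  ⌊ n /2⌋ + ⌈ n /2⌉          ≡⟨ ⌊n/2⌋+⌈n/2⌉≡n n ⟩
  n                          ∎
  where open ≤-Reasoning

≤⌊log₂⌋⇒2^≤ : ∀ k n → 1 ≤ k → k ≤ ⌊log₂ n ⌋ → 2 ^ k ≤ n
≤⌊log₂⌋⇒2^≤ (suc k) zero    _ ()
≤⌊log₂⌋⇒2^≤ k       (suc n) _ k≤ = ≤-trans (^-monoʳ-≤ 2 k≤) (2^⌊log₂n⌋≤n _ (suc n) (s≤s z≤n) refl)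

2^≤⇒≤⌊log₂⌋ : ∀ k n → 2 ^ k ≤ n → k ≤ ⌊log₂ n ⌋
2^≤⇒≤⌊log₂⌋ k n 2^k≤n = subst (_≤ ⌊log₂ n ⌋) (⌊log₂[2^n]⌋≡n k) (⌊log₂⌋-mono-≤ 2^k≤n)

-- L = ⌈ log β / 2 ⌉, so that 2 ^ L is about √β and leaves room for a and b.
linear-in-2^L : ∀ a b → ∃ λ β₀ → ∀ β → β₀ ≤ β → ∃ λ L → a * 2 ^ L + b ≤ β × ⌊log₂ β ⌋ ≤ 2 * L
-- With this threshold the lower half `K` of the logarithm is at least `a + b`, so the factor
-- `a + b` is absorbed by `2 ^ K`.
linear-in-2^L a b = 2 ^ ((a + b) + (a + b)) , λ β β₀≤β →
  let ℓ = ⌊log₂ β ⌋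
      L = ⌈ ℓ /2⌉
      K = ⌊ ℓ /2⌋
      a+b≤K = subst (_≤ K) (sym (n≡⌊n+n/2⌋ (a + b))) (⌊n/2⌋-mono (2^≤⇒≤⌊log₂⌋ _ β β₀≤β))
      open ≤-Reasoning
  in L , (begin
    a * 2 ^ L + b             ≤⟨ +-monoʳ-≤ (a * 2 ^ L) (m≤m*n b (2 ^ L) {{>-nonZero (m^n>0 2 L)}}) ⟩
    a * 2 ^ L + b * 2 ^ L     ≡⟨ *-distribʳ-+ (2 ^ L) a b ⟨
    (a + b) * 2 ^ L           ≤⟨ *-monoˡ-≤ (2 ^ L) (≤-trans a+b≤K (<⇒≤ (n<2^n K))) ⟩
    2 ^ K * 2 ^ L             ≡⟨ ^-distribˡ-+-* 2 K L ⟨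
    2 ^ (K + L)               ≡⟨ cong (2 ^_) (⌊n/2⌋+⌈n/2⌉≡n ℓ) ⟩
    2 ^ ℓ                     ≤⟨ 2^⌊log₂n⌋≤n ℓ β (≤-trans (m^n>0 2 (a + b + (a + b))) β₀≤β) refl ⟩
    β                         ∎) ,
    (begin
    ℓ                         ≡⟨ ⌊n/2⌋+⌈n/2⌉≡n ℓ ⟨
    K + L                     ≤⟨ +-monoˡ-≤ L (⌊n/2⌋≤⌈n/2⌉ ℓ) ⟩
    L + L                     ≡⟨ cong (L +_) (+-identityʳ L) ⟨
    2 * L                     ∎)

Unbounded : (ℕ → ℕ) → Set
Unbounded β = ∀ m → ∃ λ α₀ → ∀ α → α₀ ≤ α → m ≤ β α

-- `β` inverts the growth of the radii: after `i` pastings the election index is still at most `α`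
-- as long as `a * i + b ≤ β α`. This is applied with `i = 2 ^ L`, and the constant 2 comes from
-- `log β ≤ 2 L`.
adviceLowerBound : ∀ {T} (τ β : ℕ → ℕ) → (∀ D φ → T D φ ≡ D + τ φ) →
  (∀ {x y} → x ≤ y → τ x ≤ τ y) → (∀ x → x ≤ τ x) →
  ∀ a b → (∀ i α → a * i + b ≤ β α → suc (radius τ i) ≤ α) → Unbounded β →
  AdviceLowerBound T (λ α → ⌊log₂ β α ⌋)
adviceLowerBound τ β T≡ τ-mono τ-infl a b growth unbounded with linear-in-2^L a b
... | β₀ , large with unbounded β₀
... | α₀ , β₀≤β = 2 , _ , α₀ , λ α α₀≤α O A works →
  let L , small , log≤ = large (β α) (β₀≤β α α₀≤α)
      G , isG , feas , (φ , isφ , φ≤) , long = longAdvice-exists τ τ-mono τ-infl O A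
        (λ G isG feas D φ isD isφ →
          subst (ElectsWithin G A (O G)) (T≡ D φ) (works G isG feas D φ isD isφ)) L
  in G , isG , feas , (φ , isφ , ≤-trans φ≤ (growth (2 ^ L) α small)) ,
     ≤-trans log≤ (*-monoʳ-≤ 2 long)

-- Towers of twos as inverse of the iterated logarithm.

tower : ℕ → ℕ
tower zero    = 1
tower (suc e) = 2 ^ tower e

tower>0 : ∀ e → 1 ≤ tower e
tower>0 zero    = ≤-refl
tower>0 (suc e) = m^n>0 2 (tower e)

tower-+ : ∀ e d → d + tower e ≤ tower (d + e)
tower-+ e zero    = ≤-refl
tower-+ e (suc d) = ≤-trans (s≤s (tower-+ e d)) (n<2^n (tower (d + e)))

-- Holds for any fuel, as running out of it only lowers `log*-aux`.
<log*⇒tower≤ : ∀ e fuel x → e < log*-aux fuel x → tower e ≤ x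
<log*⇒tower≤ e       (suc fuel) x e< with x ≤ᵇ 1 in eq
<log*⇒tower≤ e       (suc fuel) x ()       | true
<log*⇒tower≤ zero    (suc fuel) zero _     | false with () ← eq
<log*⇒tower≤ zero    (suc fuel) (suc x) _  | false = s≤s z≤n
<log*⇒tower≤ (suc e) (suc fuel) x (s≤s e<) | false =
  ≤⌊log₂⌋⇒2^≤ (tower e) x (tower>0 e) (<log*⇒tower≤ e fuel ⌊log₂ x ⌋ e<)

-- Fuel that bounds the argument stays sufficient, because `⌊log₂ x ⌋ < x` for positive `x`.
tower≤⇒≤log* : ∀ m fuel x → x ≤ fuel → tower m ≤ x → m ≤ log*-aux fuel x
tower≤⇒≤log* zero    fuel       x _  _   = z≤n
tower≤⇒≤log* (suc m) zero       x x≤ t≤x = ⊥-elim (<⇒≱ (tower>0 (suc m)) (≤-trans t≤x x≤))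
tower≤⇒≤log* (suc m) (suc fuel) x x≤ t≤x with x ≤ᵇ 1 in eq
... | true  = ⊥-elim (<⇒≱ (≤-trans (^-monoʳ-≤ 2 (tower>0 m)) t≤x) (≤ᵇ⇒≤ x 1 (subst T (sym eq) tt)))
... | false = s≤s (tower≤⇒≤log* m fuel ⌊log₂ x ⌋
  (s≤s⁻¹ (≤-trans (<-≤-trans (n<2^n ⌊log₂ x ⌋)
    (2^⌊log₂n⌋≤n _ x (≤-trans (m^n>0 2 (tower m)) t≤x) refl)) x≤))
  (2^≤⇒≤⌊log₂⌋ (tower m) x t≤x))

-- Growth of the radii for the four time bounds.

unbounded-log : ∀ {β} → Unbounded β → Unbounded (λ α → ⌊log₂ β α ⌋)
unbounded-log {β} unb m = let α₀ , large = unb (2 ^ m) in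
  α₀ , λ α α₀≤α → 2^≤⇒≤⌊log₂⌋ m (β α) (large α α₀≤α)

unbounded-id : Unbounded id
unbounded-id m = m , λ _ m≤α → m≤α

unbounded-log* : Unbounded log*
unbounded-log* m = tower m , λ α → tower≤⇒≤log* m α α ≤-refl

-- Absorbs the additive 3 of the recurrence into the exponent.
3+2^y≤2^[2+y] : ∀ y → 3 + 2 ^ y ≤ 2 ^ (2 + y)
3+2^y≤2^[2+y] y = ≤-trans (+-monoˡ-≤ (2 ^ y) (*-monoʳ-≤ 3 (m^n>0 2 y))) (≤-reflexive (regroup (2 ^ y)))
  where
  regroup : ∀ p → 3 * p + p ≡ 2 * (2 * p)
  regroup = solve-∀

module _ (c : ℕ) where
  open ≤-Reasoning

  radius-+ : ∀ i → suc (radius (_+ c) i) ≡ (3 + c) * i + 1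
  radius-+ zero    = cong (_+ 1) (sym (*-zeroʳ (3 + c)))
  radius-+ (suc i) = trans (cong (λ ρ → 3 + (ρ + c)) (radius-+ i)) (regroup c i)
    where
    regroup : ∀ c i → 3 + ((3 + c) * i + 1 + c) ≡ (3 + c) * suc i + 1
    regroup = solve-∀

  -- Each pasting multiplies the radius plus one by at most `3 + c`.
  radius-* : ∀ i → suc (radius (c *_) i) ≤ 2 ^ ((3 + c) * i + 1)
  radius-* zero    = subst (λ e → 1 ≤ 2 ^ (e + 1)) (sym (*-zeroʳ (3 + c))) (s≤s z≤n)
  radius-* (suc i) = begin
    3 + c * suc ρ              ≤⟨ +-monoˡ-≤ (c * suc ρ) (*-monoʳ-≤ 3 (s≤s (z≤n {ρ}))) ⟩
    3 * suc ρ + c * suc ρ      ≡⟨ *-distribʳ-+ (suc ρ) 3 c ⟨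
    (3 + c) * suc ρ            ≤⟨ *-mono-≤ (<⇒≤ (n<2^n (3 + c))) (radius-* i) ⟩
    2 ^ (3 + c) * 2 ^ e        ≡⟨ ^-distribˡ-+-* 2 (3 + c) e ⟨
    2 ^ (3 + c + e)            ≡⟨ cong (2 ^_) (regroup c i) ⟩
    2 ^ ((3 + c) * suc i + 1)  ∎
    where
    ρ e : ℕ
    ρ = radius (c *_) i
    e = (3 + c) * i + 1
    regroup : ∀ c i → 3 + c + ((3 + c) * i + 1) ≡ (3 + c) * suc i + 1
    regroup = solve-∀

  -- A `c`-th power multiplies the exponent by `c`, so the exponent itself grows exponentially.
  radius-^ : ∀ i → suc (radius (_^ c) i) ≤ 2 ^ (2 ^ ((2 + c) * i + 1))
  radius-^ zero    = m^n>0 2 (2 ^ ((2 + c) * 0 + 1))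
  radius-^ (suc i) = begin
    3 + suc ρ ^ c                   ≤⟨ +-monoʳ-≤ 3 (^-monoˡ-≤ c (radius-^ i)) ⟩
    3 + (2 ^ 2 ^ e) ^ c             ≡⟨ cong (3 +_) (^-*-assoc 2 (2 ^ e) c) ⟩
    3 + 2 ^ (2 ^ e * c)             ≤⟨ 3+2^y≤2^[2+y] (2 ^ e * c) ⟩
    2 ^ (2 + 2 ^ e * c)             ≤⟨ ^-monoʳ-≤ 2 (begin
      2 + 2 ^ e * c                   ≤⟨ +-monoˡ-≤ _ (*-monoˡ-≤ 2 (m^n>0 2 e)) ⟩
      2 ^ e * 2 + 2 ^ e * c           ≡⟨ *-distribˡ-+ (2 ^ e) 2 c ⟨
      2 ^ e * (2 + c)                 ≤⟨ *-monoʳ-≤ (2 ^ e) (<⇒≤ (n<2^n (2 + c))) ⟩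
      2 ^ e * 2 ^ (2 + c)             ≡⟨ ^-distribˡ-+-* 2 e (2 + c) ⟨
      2 ^ (e + (2 + c))               ≡⟨ cong (2 ^_) (regroup c i) ⟩
      2 ^ ((2 + c) * suc i + 1)       ∎) ⟩
    2 ^ (2 ^ ((2 + c) * suc i + 1)) ∎
    where
    ρ e : ℕ
    ρ = radius (_^ c) i
    e = (2 + c) * i + 1
    regroup : ∀ c i → (2 + c) * i + 1 + (2 + c) ≡ (2 + c) * suc i + 1
    regroup = solve-∀

  -- Each pasting costs two exponentials, and `2 + c` further levels of the tower pay for the
  -- constants.
  radius-exp : 1 < c → ∀ i → suc (radius (c ^_) i) ≤ tower ((4 + c) * i)
  radius-exp 1<c zero    = tower>0 ((4 + c) * 0)
  radius-exp 1<c (suc i) = begin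
    3 + c ^ suc ρ               ≤⟨ +-monoʳ-≤ 3 (^-monoʳ-≤ c {{>-nonZero (<⇒≤ 1<c)}} (radius-exp 1<c i)) ⟩
    3 + c ^ t                   ≤⟨ +-monoʳ-≤ 3 (^-monoˡ-≤ t (<⇒≤ (n<2^n c))) ⟩
    3 + (2 ^ c) ^ t             ≡⟨ cong (3 +_) (^-*-assoc 2 c t) ⟩
    3 + 2 ^ (c * t)             ≤⟨ 3+2^y≤2^[2+y] (c * t) ⟩
    2 ^ (2 + c * t)             ≤⟨ ^-monoʳ-≤ 2 (begin
      2 + c * t                   ≤⟨ +-monoˡ-≤ (c * t) (*-monoʳ-≤ 2 (tower>0 e)) ⟩
      2 * t + c * t               ≡⟨ *-distribʳ-+ t 2 c ⟨
      (2 + c) * t                 ≤⟨ *-mono-≤ (<⇒≤ (n<2^n (2 + c))) (<⇒≤ (n<2^n t)) ⟩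
      2 ^ (2 + c) * 2 ^ t         ≡⟨ ^-distribˡ-+-* 2 (2 + c) t ⟨
      2 ^ (2 + c + t)             ≤⟨ ^-monoʳ-≤ 2 (tower-+ e (2 + c)) ⟩
      2 ^ tower (2 + c + e)       ∎) ⟩
    tower (2 + (2 + c + e))     ≡⟨ cong tower (regroup c i) ⟩
    tower ((4 + c) * suc i)     ∎
    where
    ρ e t : ℕ
    ρ = radius (c ^_) i
    e = (4 + c) * i
    t = tower e
    regroup : ∀ c i → 2 + (2 + c + (4 + c) * i) ≡ (4 + c) * suc i
    regroup = solve-∀

-- The four lower bounds.

theorem5 : (c : ℕ) → 1 < c →
    AdviceLowerBound (λ D φ → D + φ + c) (λ α → ⌊log₂ α ⌋) ×
    AdviceLowerBound (λ D φ → D + c * φ) (λ α → ⌊log₂ ⌊log₂ α ⌋ ⌋) ×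
    AdviceLowerBound (λ D φ → D + φ ^ c) (λ α → ⌊log₂ ⌊log₂ ⌊log₂ α ⌋ ⌋ ⌋) ×
    AdviceLowerBound (λ D φ → D + c ^ φ) (λ α → ⌊log₂ log* α ⌋)
theorem5 c 1<c =
  adviceLowerBound (_+ c) id (λ D φ → +-assoc D φ c) (+-monoˡ-≤ c) (λ x → m≤m+n x c) (3 + c) 1
    (λ i α ≤α → ≤-trans (≤-reflexive (radius-+ c i)) ≤α)
    unbounded-id ,
  adviceLowerBound (c *_) (λ α → ⌊log₂ α ⌋) (λ _ _ → refl) (*-monoʳ-≤ c)
    (λ x → m≤n*m x c) (3 + c) 1
    -- The summand `b = 1` provides the positive exponent needed to invert the logarithm.
    (λ i α ≤log → ≤-trans (radius-* c i) (≤⌊log₂⌋⇒2^≤ _ α (m≤n+m 1 _) ≤log))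
    (unbounded-log unbounded-id) ,
  adviceLowerBound (_^ c) (λ α → ⌊log₂ ⌊log₂ α ⌋ ⌋) (λ _ _ → refl) (^-monoˡ-≤ c)
    x≤x^c (2 + c) 1
    (λ i α ≤loglog → ≤-trans (radius-^ c i) (≤⌊log₂⌋⇒2^≤ (2 ^ ((2 + c) * i + 1)) α (m^n>0 2 ((2 + c) * i + 1))
      (≤⌊log₂⌋⇒2^≤ ((2 + c) * i + 1) ⌊log₂ α ⌋ (m≤n+m 1 _) ≤loglog)))
    (unbounded-log (unbounded-log unbounded-id)) ,
  adviceLowerBound (c ^_) log* (λ _ _ → refl) (^-monoʳ-≤ c)
    (λ x → ≤-trans (<⇒≤ (n<2^n x)) (^-monoˡ-≤ x 1<c)) (4 + c) 1
    -- Here `b = 1` provides the strict inequality below `log* α`.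
    (λ i α ≤log* → ≤-trans (radius-exp c 1<c i)
      (<log*⇒tower≤ _ α α (≤-trans (≤-reflexive (+-comm 1 _)) ≤log*)))
    unbounded-log*
  where
  instance
    c≢0 : NonZero c
    c≢0 = >-nonZero (<⇒≤ 1<c)
  x≤x^c : ∀ x → x ≤ x ^ c
  x≤x^c zero    = z≤n
  x≤x^c (suc x) = ≤-trans (≤-reflexive (sym (^-identityʳ (suc x)))) (^-monoʳ-≤ (suc x) (<⇒≤ 1<c))
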